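{- For the hop-constrained minimum spanning tree problem (HMSTP), i.e. the HSTP with $R=V$, the partial-ordering model (P-HSTP) is strictly stronger than the assignment model (A-HSTP): for every HMSTP instance $\nu_{\text{P-HSTP}}\ge\nu_{\text{A-HSTP}}$, and there exist HMSTP instances for which this inequality is strict.
   Context: HMSTP instance: a complete undirected graph $G=(V,E)$ with edge costs $c:E\to\mathbb{R}_{>0}$, a root $r\in V$, a hop limit $H\ge1$, and terminal set $R=V$. For every ordered pair $(u,v)$ of distinct nodes there is a variable $x_{u,v}$. Common $x$-constraints: (X1) $\sum_{u\neq v}x_{u,v}\le1$ for all $v\in V$; (X2) $\sum_{u\in V\setminus\{v,w\}}x_{u,v}\ge x_{v,w}$ for all $v\in V\setminus\{r\}$, $w\neq v$; (X3) $0\le x_{u,v}\le1$; (X4) $\sum_{u\neq v}x_{u,v}\ge1$ for all $v\in R\setminus\{r\}$. $\mathcal{P}^{HSTP}$: all $(x,l,g)$ (with $l_{v,i},g_{i,v}$ for $v\in V$, $i=0,\dots,H$) satisfying (X1)–(X4) and $l_{r,0}=g_{0,r}=0$; $l_{v,1}=g_{H,v}=0$ for $v\neq r$; $l_{v,i}\le l_{v,i+1}$ and $g_{i,v}+l_{v,i+1}=1$ for $v\in V$, $i=0,\dots,H-1$; $l_{u,i}+g_{i,v}\ge x_{u,v}$ for $u\neq v$, $i=0,\dots,H$; $0\le l,g\le1$. $\mathcal{A}^{HSTP}$: all $(x,y)$ (with $y_{v,i}$ for $v\in V$, $i=0,\dots,H$) satisfying (X1)–(X4) and $y_{r,0}=1$;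 $y_{r,i}=0$ for $i\ge1$; $y_{v,0}=0$ and $\sum_{i=1}^Hy_{v,i}=1$ for $v\neq r$; $y_{u,i}-y_{v,i+1}+x_{u,v}\le1$ for $u\neq v$, $i=0,\dots,H-1$; $y_{u,H}+x_{u,v}\le1$ for $u\neq v$; $0\le y\le1$. (A-HSTP) and (P-HSTP) minimize $\sum_{uv\in E}c_{uv}(x_{u,v}+x_{v,u})$ over the integral points of $\mathcal{A}^{HSTP}$ and $\mathcal{P}^{HSTP}$ respectively. $\nu_M$ is the optimal value of the LP relaxation of ILP $M$. For a minimization problem, model $A$ is strictly stronger than $B$ if $\nu_A\ge\nu_B$ on all instances and strict inequality holds for some instance. -}

module Defs where

open import Algebra.Bundles using (CommutativeRing)
open import Algebra.Core using (Op₁; Op₂)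
open import Algebra.Structures using (IsCommutativeRing)
open import Data.Bool.Base using (if_then_else_)
open import Data.Fin.Base using (Fin; zero; suc; inject₁; fromℕ; fromℕ<)
open import Data.Fin.Properties using (_≟_; _<?_)
open import Data.Fin.Subset using (Subset; ⊤; _∈_)
open import Data.Nat.Base as ℕ using (ℕ; s≤s)
open import Data.Product.Base using (_×_; ∃; ∃₂)
open import Data.Sum.Base using (_⊎_)
open import Level using (0ℓ)
open import Relation.Binary.Core using (Rel)
open import Relation.Binary.PropositionalEquality.Core using (_≢_)
open import Relation.Binary.Structures using (IsDecTotalOrder)
open import Relation.Nullary.Decidable using (does; ¬?; _×-dec_)
open import Relation.Nullary.Negation using (¬_)
open import Relation.Unary using (Decidable)
import Algebra.Properties.CommutativeMonoid.Sum as Sum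
import Relation.Binary.Construct.NonStrictToStrict as ToStrict

module _ {A : Set} (_≤_ : Rel A 0ℓ) where

  UpperBound LowerBound IsSupremum IsInfimum : (A → Set) → A → Set
  UpperBound S b = ∀ s → S s → s ≤ b
  LowerBound S b = ∀ s → S s → b ≤ s
  IsSupremum S m = UpperBound S m × (∀ b → UpperBound S b → m ≤ b)
  IsInfimum  S m = LowerBound S m × (∀ b → LowerBound S b → b ≤ m)

-- The real numbers, characterised (classically, up to unique isomorphism) as
-- a Dedekind-complete ordered field.
record CompleteOrderedField : Set₁ where
  infix  8 -_
  infixl 7 _*_
  infixl 6 _+_
  infix  4 _≈_ _≤_
  field
    Carrier           : Set
    _≈_ _≤_           : Rel Carrier 0ℓ
    _+_ _*_           : Op₂ Carrier
    -_                : Op₁ Carrier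
    0# 1#             : Carrier
    isCommutativeRing : IsCommutativeRing _≈_ _+_ _*_ -_ 0# 1#
    0≉1               : ¬ (0# ≈ 1#)
    inverse           : ∀ x → ¬ (x ≈ 0#) → ∃ λ y → x * y ≈ 1#
    isDecTotalOrder   : IsDecTotalOrder _≈_ _≤_
    +-monoˡ-≤         : ∀ z {x y} → x ≤ y → x + z ≤ y + z
    *-nonNeg          : ∀ {x y} → 0# ≤ x → 0# ≤ y → 0# ≤ x * y
    complete          : (S : Carrier → Set) → ∃ S → ∃ (UpperBound _≤_ S) → ∃ (IsSupremum _≤_ S)

  commutativeRing : CommutativeRing 0ℓ 0ℓ
  commutativeRing = record { isCommutativeRing = isCommutativeRing }

module HMSTP (ℝ : CompleteOrderedField) where

  open CompleteOrderedField ℝ using (Carrier; _≤_)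
  open CommutativeRing (CompleteOrderedField.commutativeRing ℝ) public
    using (_≈_; _+_; _*_; _-_; 0#; 1#; +-commutativeMonoid)
  open ToStrict _≈_ _≤_ public using (_<_)
  open Sum +-commutativeMonoid public using (sum)

  sumOver : ∀ {n} {P : Fin n → Set} → Decidable P → (Fin n → Carrier) → Carrier
  sumOver P? f = sum λ i → if does (P? i) then f i else 0#

  InUnitInterval : Carrier → Set
  InUnitInterval z = 0# ≤ z × z ≤ 1#

  -- The node set is Fin n. The cost of the edge {u,v} is cost u v; the diagonal
  -- of cost is never used.
  record Instance : Set where
    field
      n        : ℕ
      cost     : Fin n → Fin n → Carrier
      cost-sym : ∀ u v → u ≢ v → cost u v ≈ cost v u
      cost-pos : ∀ u v → u ≢ v → 0# < cost u v
      root     : Fin n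
      H        : ℕ
      H≥1      : 1 ℕ.≤ H

    terminals : Subset n
    terminals = ⊤

  -- A binary program given by its polyhedron; all the variables below are
  -- constrained to [0,1], so integral points are those with 0/1 coordinates.
  record ILP : Set₁ where
    field
      Point      : Set
      Polyhedron : Point → Set
      Integral   : Point → Set
      objective  : Point → Carrier

  Binary : Carrier → Set
  Binary z = z ≈ 0# ⊎ z ≈ 1#

  -- ν is the optimal value of the LP relaxation, which minimises over the whole
  -- polyhedron, disregarding Integral. For the two LPs below, which are feasible
  -- and have nonnegative objective, this infimum is a minimum.
  IsLPValue : ILP → Carrier → Set
  IsLPValue M ν = IsInfimum _≤_ (λ t → ∃ λ p → Polyhedron p × objective p ≈ t) ν
    where open ILP M

  Model : Set₁
  Model = Instance → ILP

  -- For minimisation problems. Infima are unique up to ≈, so the existential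
  -- quantifiers say that ν_A and ν_B exist and satisfy the stated inequality.
  StrictlyStronger : Model → Model → Set
  StrictlyStronger A B =
      (∀ I → ∃₂ λ νA νB → IsLPValue (A I) νA × IsLPValue (B I) νB × νB ≤ νA)
    × (∃ λ I → ∃₂ λ νA νB → IsLPValue (A I) νA × IsLPValue (B I) νB × νB < νA)

  module _ (I : Instance) where
    open Instance I

    -- Variables x u v for u ≢ v; the diagonal entries are unconstrained dummies
    -- that occur neither in the constraints nor in the objective.
    ArcVars : Set
    ArcVars = Fin n → Fin n → Carrier

    arcCost : ArcVars → Carrier
    arcCost x = sum λ u → sumOver (λ v → u <? v) λ v → cost u v * (x u v + x v u)

    record XConstraints (x : ArcVars) : Set where
      field
        X1 : ∀ v → sumOver (λ u → ¬? (u ≟ v)) (λ u → x u v) ≤ 1#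
        X2 : ∀ v w → v ≢ root → w ≢ v →
             x v w ≤ sumOver (λ u → ¬? (u ≟ v) ×-dec ¬? (u ≟ w)) (λ u → x u v)
        X3 : ∀ u v → u ≢ v → InUnitInterval (x u v)
        X4 : ∀ v → v ∈ terminals → v ≢ root →
             1# ≤ sumOver (λ u → ¬? (u ≟ v)) (λ u → x u v)

    -- Positions 0,…,H are Fin (suc H). For i : Fin H, inject₁ i and suc i
    -- are the positions i and i + 1, so suc i also ranges over 1,…,H.
    Position : Set
    Position = Fin (ℕ.suc H)

    position₁ positionH : Position
    position₁ = fromℕ< (s≤s H≥1)
    positionH = fromℕ H

    record PPoint : Set where
      field
        x : ArcVars
        l : Fin n → Position → Carrier
        g : Position → Fin n → Carrier

    record PPolyhedron (p : PPoint) : Set where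
      open PPoint p
      field
        xConstraints : XConstraints x
        l-root       : l root zero ≈ 0#
        g-root       : g zero root ≈ 0#
        l-first      : ∀ v → v ≢ root → l v position₁ ≈ 0#
        g-last       : ∀ v → v ≢ root → g positionH v ≈ 0#
        l-mono       : ∀ v (i : Fin H) → l v (inject₁ i) ≤ l v (suc i)
        g+l          : ∀ v (i : Fin H) → g (inject₁ i) v + l v (suc i) ≈ 1#
        link         : ∀ u v → u ≢ v → ∀ i → x u v ≤ l u i + g i v
        l-bounds     : ∀ v i → InUnitInterval (l v i)
        g-bounds     : ∀ v i → InUnitInterval (g i v)

    record APoint : Set where
      field
        x : ArcVars
        y : Fin n → Position → Carrier

    record APolyhedron (p : APoint) : Set where
      open APoint p
      field
        xConstraints : XConstraints x
        y-root-zero  : y root zero ≈ 1#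
        y-root-suc   : ∀ (i : Fin H) → y root (suc i) ≈ 0#
        y-zero       : ∀ v → v ≢ root → y v zero ≈ 0#
        y-assign     : ∀ v → v ≢ root → sum (λ (i : Fin H) → y v (suc i)) ≈ 1#
        link         : ∀ u v → u ≢ v → ∀ (i : Fin H) →
                       (y u (inject₁ i) - y v (suc i)) + x u v ≤ 1#
        link-last    : ∀ u v → u ≢ v → y u positionH + x u v ≤ 1#
        y-bounds     : ∀ v i → InUnitInterval (y v i)

  P-HSTP : Model
  P-HSTP I = record
    { Point      = PPoint I
    ; Polyhedron = PPolyhedron I
    ; Integral   = λ p → let open PPoint p in
                     (∀ u v → u ≢ v → Binary (x u v))
                   × (∀ v i → Binary (l v i))
                   × (∀ v i → Binary (g i v))
    ; objective  = λ p → arcCost I (PPoint.x p)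
    }

  A-HSTP : Model
  A-HSTP I = record
    { Point      = APoint I
    ; Polyhedron = APolyhedron I
    ; Integral   = λ p → let open APoint p in
                     (∀ u v → u ≢ v → Binary (x u v))
                   × (∀ v i → Binary (y v i))
    ; objective  = λ p → arcCost I (APoint.x p)
    }

{-# OPTIONS --safe #-}

-- For ν_A ≤ ν_P, every feasible (x, l, g) of P yields a y with (x, y) feasible for A.
-- For v other than the root put U v i = 1 − l v i, and let T send y to
--   (T y) v (i + 1) = min (U v (i + 1), Σ_u x u v · y u i),
-- with the missing mass at position 1. T preserves y ≥ 0, Σ_i y v i = 1 and y ≤ U, and
-- y u i + x u v ≤ 1 + (T y) v (i + 1), so a fixed point of T is the required y. Instead of
-- Brouwer's theorem we use that the constraints are linear: the averages of y, T y, …,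
-- T^(N−1) y satisfy them up to an error 1/N, and Fourier–Motzkin elimination shows that a
-- linear system solvable up to arbitrarily small errors is solvable.
--
-- The gap occurs for four nodes and H = 2, where ν_P ≥ 5 and a half-integral point of A costs 9/2.

module Submission where

open import Defs

open import Algebra.Bundles using (CommutativeRing)
import Algebra.Construct.NaturalChoice.Max as Max
import Algebra.Construct.NaturalChoice.Min as Min
import Algebra.Properties.CommutativeSemigroup as CommutativeSemigroupProperties
import Algebra.Properties.Ring as RingProperties
import Algebra.Properties.Semiring.Mult as Mult
import Algebra.Properties.Semiring.Sum as SemiringSum
import Algebra.Solver.Ring.NaturalCoefficients.Default as Solver
open import Data.Bool.Base using (if_then_else_; true; false)
open import Data.Bool.Properties using (if-float)
open import Data.Fin.Base using (Fin; zero; suc; inject₁; fromℕ; combine; remQuot)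
open import Data.Fin.Patterns using (0F; 1F; 2F; 3F)
open import Data.Fin.Properties using (_≟_; _<?_; <⇒≢; all?; remQuot-combine)
open import Data.Fin.Subset.Properties using (∈⊤)
open import Data.List.Base using (List; []; _∷_; [_]; _++_; concat; tabulate; cartesianProductWith)
open import Data.List.Membership.Propositional using (_∈_)
open import Data.List.Membership.Propositional.Properties using (∈-cartesianProductWith⁺; ∈-cartesianProductWith⁻)
open import Data.List.Relation.Unary.All as All using (All; []; _∷_)
open import Data.List.Relation.Unary.All.Properties
  using (++⁺; ++⁻ˡ; ++⁻ʳ; concat⁺; concat⁻; tabulate⁺; tabulate⁻)
open import Data.Nat.Base as ℕ using (ℕ; zero; suc; s≤s; z≤n)
import Data.Nat.Properties as ℕ
open import Data.Product.Base using (_×_; _,_; ∃; proj₁; proj₂; uncurry)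
open import Data.Sum.Base using (inj₁; inj₂; [_,_]′)
open import Data.Vec.Base using (Vec; []; _∷_; lookup)
import Data.Vec.Functional as V
open import Function.Base using (_∘_; id)
open import Relation.Binary.Bundles using (DecTotalOrder)
open import Relation.Binary.PropositionalEquality as ≡ using (_≡_; _≢_; ≢-sym)
import Relation.Binary.Reasoning.PartialOrder as PosetReasoning
open import Relation.Nullary.Decidable using (Dec; yes; no; does; ¬?; _×-dec_; _→-dec_; from-yes)
open import Relation.Nullary.Negation using (¬_; contradiction)
open import Relation.Unary using (Decidable)

-- P asks only that the tail of an arc precede its head, while A asks that the two be consecutive.
-- So the increments of `l` do not give a feasible y, even at an integral point. U v i is the share
-- of v at position i or later, and the link x u v ≤ l u i + g i v reads U u i + x u v ≤ 1 + U v (i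
-- + 1). Thus, away from the root, U itself meets the arc inequalities of A; what fails is the row
-- sum, as U v 1 is already 1. A smaller y must keep y v (i + 1) large wherever y u i + x u v
-- exceeds 1, and since a fractional x may contain cycles, this cannot be settled node by node:
-- hence a fixed point. The cap by U controls the mass at position H. Placing the missing mass at
-- position 1 leaves room for the arc from the root, as the mass beyond position 1 is at most the
-- inflow from the other nodes. Averages suffice because the arc inequality relates y to T y and
-- therefore telescopes along the orbit.

module _ (ℝ : CompleteOrderedField) where

  open CompleteOrderedField ℝ
    using (Carrier; _≤_; inverse; 0≉1; complete; +-monoˡ-≤; *-nonNeg; isDecTotalOrder)
  open CommutativeRing (CompleteOrderedField.commutativeRing ℝ)
    using ( _≈_; _+_; _*_; -_; _-_; 0#; 1#; ring; semiring; commutativeSemiring; +-commutativeSemigroup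
          ; refl; sym; trans; reflexive; +-cong; +-congˡ; +-congʳ; +-assoc; +-comm; +-identityˡ; +-identityʳ
          ; *-congˡ; *-congʳ; *-assoc; *-comm; *-identityˡ; *-identityʳ
          ; distribˡ; zeroˡ; zeroʳ; -‿inverseˡ; -‿inverseʳ; -‿cong)
  open CommutativeSemigroupProperties +-commutativeSemigroup using (interchange)
  open RingProperties ring using (-‿distribˡ-*; -‿distribʳ-*; -‿involutive; -0#≈0#)
  open SemiringSum semiring
    using (sum; sum-cong-≋; sum-init-last; ∑-distrib-+; ∑-comm; *-distribˡ-sum; sum-replicate-zero)
  open Mult semiring using (×-homo-+; ×-congʳ; ×-comm-*; ×-assoc-*; ×-assocˡ) renaming (_×_ to _·_)
  module Solve = Solver commutativeSemiring
  open Solve using (solve; _:=_; _:+_; _:*_; con)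

  -- Ordered-field arithmetic and finite sums

  decTotalOrder : DecTotalOrder _ _ _
  decTotalOrder = record { isDecTotalOrder = isDecTotalOrder }

  open DecTotalOrder decTotalOrder
    using (poset; totalOrder; total; antisym; _≤?_; ≤-respˡ-≈; ≤-respʳ-≈)
    renaming (refl to ≤-refl; reflexive to ≤-reflexive; trans to ≤-trans)
  open Min totalOrder using (_⊓_; x⊓y≤x; x⊓y≤y; ⊓-glb; mono-≤-distrib-⊓)
  open Max totalOrder using (_⊔_; x≤x⊔y; x≤y⊔x; ⊔-lub)
  open PosetReasoning poset

  +-monoʳ-≤ : ∀ z {x y} → x ≤ y → z + x ≤ z + y
  +-monoʳ-≤ z {x} {y} x≤y = begin
    z + x ≈⟨ +-comm z x ⟩
    x + z ≤⟨ +-monoˡ-≤ z x≤y ⟩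
    y + z ≈⟨ +-comm y z ⟩
    z + y ∎

  +-mono-≤ : ∀ {w x y z} → w ≤ x → y ≤ z → w + y ≤ x + z
  +-mono-≤ w≤x y≤z = ≤-trans (+-monoˡ-≤ _ w≤x) (+-monoʳ-≤ _ y≤z)

  x-z+z≈x : ∀ x z → x - z + z ≈ x
  x-z+z≈x x z = trans (+-assoc x (- z) z) (trans (+-congˡ (-‿inverseˡ z)) (+-identityʳ x))

  x+z-z≈x : ∀ x z → x + z - z ≈ x
  x+z-z≈x x z = trans (+-assoc x z (- z)) (trans (+-congˡ (-‿inverseʳ z)) (+-identityʳ x))

  +-cancelʳ-≤ : ∀ z {x y} → x + z ≤ y + z → x ≤ y
  +-cancelʳ-≤ z {x} {y} x+z≤y+z = begin
    x         ≈⟨ x+z-z≈x x z ⟨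
    x + z - z ≤⟨ +-monoˡ-≤ (- z) x+z≤y+z ⟩
    y + z - z ≈⟨ x+z-z≈x y z ⟩
    y         ∎

  +-cancelˡ-≤ : ∀ z {x y} → z + x ≤ z + y → x ≤ y
  +-cancelˡ-≤ z {x} {y} z+x≤z+y = +-cancelʳ-≤ z (begin
    x + z ≈⟨ +-comm x z ⟩
    z + x ≤⟨ z+x≤z+y ⟩
    z + y ≈⟨ +-comm z y ⟩
    y + z ∎)

  x≤y+z⇒x-z≤y : ∀ {x y z} → x ≤ y + z → x - z ≤ y
  x≤y+z⇒x-z≤y {x} {y} {z} x≤y+z = +-cancelʳ-≤ z (≤-respˡ-≈ (sym (x-z+z≈x x z)) x≤y+z)

  x+z≤y⇒x≤y-z : ∀ {x y z} → x + z ≤ y → x ≤ y - z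
  x+z≤y⇒x≤y-z {x} {y} {z} x+z≤y = +-cancelʳ-≤ z (≤-respʳ-≈ (sym (x-z+z≈x y z)) x+z≤y)

  x≤x+y : ∀ x {y} → 0# ≤ y → x ≤ x + y
  x≤x+y x 0≤y = ≤-respˡ-≈ (+-identityʳ x) (+-monoʳ-≤ x 0≤y)

  x≤y+x : ∀ x {y} → 0# ≤ y → x ≤ y + x
  x≤y+x x 0≤y = ≤-respˡ-≈ (+-identityˡ x) (+-monoˡ-≤ x 0≤y)

  +-nonNeg : ∀ {x y} → 0# ≤ x → 0# ≤ y → 0# ≤ x + y
  +-nonNeg 0≤x 0≤y = ≤-trans 0≤x (x≤x+y _ 0≤y)

  x≤y⇒0≤y-x : ∀ {x y} → x ≤ y → 0# ≤ y - x
  x≤y⇒0≤y-x x≤y = x+z≤y⇒x≤y-z (≤-respˡ-≈ (sym (+-identityˡ _)) x≤y)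

  0≤y-x⇒x≤y : ∀ {x y} → 0# ≤ y - x → x ≤ y
  0≤y-x⇒x≤y {x} {y} 0≤y-x = ≤-respʳ-≈ (x-z+z≈x y x) (x≤y+x x 0≤y-x)

  neg-antimono-≤ : ∀ {x y} → x ≤ y → - y ≤ - x
  neg-antimono-≤ {x} {y} x≤y = ≤-respʳ-≈ (+-identityˡ (- x)) (x+z≤y⇒x≤y-z (begin
    - y + x ≤⟨ +-monoʳ-≤ (- y) x≤y ⟩
    - y + y ≈⟨ -‿inverseˡ y ⟩
    0#      ∎))

  *-monoˡ-≤ : ∀ {z x y} → 0# ≤ z → x ≤ y → z * x ≤ z * y
  *-monoˡ-≤ {z} {x} {y} 0≤z x≤y = 0≤y-x⇒x≤y (begin
    0#              ≤⟨ *-nonNeg 0≤z (x≤y⇒0≤y-x x≤y) ⟩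
    z * (y - x)     ≈⟨ distribˡ z y (- x) ⟩
    z * y + z * - x ≈⟨ +-congˡ (-‿distribʳ-* z x) ⟨
    z * y - z * x   ∎)

  0≤1 : 0# ≤ 1#
  0≤1 with total 0# 1#
  ... | inj₁ 0≤1 = 0≤1
  ... | inj₂ 1≤0 = begin
    0#          ≤⟨ *-nonNeg 0≤-1 0≤-1 ⟩
    - 1# * - 1# ≈⟨ -‿distribˡ-* 1# (- 1#) ⟨
    - (1# * - 1#) ≈⟨ -‿cong (*-identityˡ (- 1#)) ⟩
    - - 1#      ≈⟨ -‿involutive 1# ⟩
    1#          ∎
    where
    0≤-1 = ≤-respˡ-≈ -0#≈0# (neg-antimono-≤ 1≤0)

  -- This is (1 - x)(1 - y) ≥ 0 expanded. It is what lets the products in the inflow imply a linear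
  -- arc inequality.
  x+y≤1+xy : ∀ {x y} → x ≤ 1# → y ≤ 1# → x + y ≤ 1# + x * y
  x+y≤1+xy {x} {y} x≤1 y≤1 = begin
    x + y                     ≈⟨ +-congˡ (trans (*-congʳ (x-z+z≈x 1# x)) (*-identityˡ y)) ⟨
    x + (1# - x + x) * y      ≈⟨ solve 3 (λ x y d → x :+ (d :+ x) :* y := x :+ d :* y :+ x :* y) refl x y (1# - x) ⟩
    x + (1# - x) * y + x * y  ≤⟨ +-monoˡ-≤ _ (+-monoʳ-≤ x (*-monoˡ-≤ (x≤y⇒0≤y-x x≤1) y≤1)) ⟩
    x + (1# - x) * 1# + x * y ≈⟨ +-congʳ (trans (+-congˡ (*-identityʳ _)) (trans (+-comm x _) (x-z+z≈x 1# x))) ⟩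
    1# + x * y                ∎

  n·-nonNeg : ∀ n {x} → 0# ≤ x → 0# ≤ n · x
  n·-nonNeg zero    0≤x = ≤-refl
  n·-nonNeg (suc n) 0≤x = +-nonNeg 0≤x (n·-nonNeg n 0≤x)

  sum-mono-≤ : ∀ {n} {f g : Fin n → Carrier} → (∀ i → f i ≤ g i) → sum f ≤ sum g
  sum-mono-≤ {zero}  f≤g = ≤-refl
  sum-mono-≤ {suc n} f≤g = +-mono-≤ (f≤g zero) (sum-mono-≤ (f≤g ∘ suc))

  sum-nonNeg : ∀ {n} {f : Fin n → Carrier} → (∀ i → 0# ≤ f i) → 0# ≤ sum f
  sum-nonNeg {n} 0≤f = ≤-respˡ-≈ (sum-replicate-zero n) (sum-mono-≤ 0≤f)

  term≤sum : ∀ {n} {f : Fin n → Carrier} → (∀ i → 0# ≤ f i) → ∀ i → f i ≤ sum f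
  term≤sum 0≤f zero    = x≤x+y _ (sum-nonNeg (0≤f ∘ suc))
  term≤sum 0≤f (suc i) = ≤-trans (term≤sum (0≤f ∘ suc) i) (x≤y+x _ (0≤f zero))

  term+sum≤sum : ∀ {n} {f g : Fin n → Carrier} → (∀ i → f i ≤ g i) →
                 ∀ {c} i → c + f i ≤ g i → c + sum f ≤ sum g
  term+sum≤sum f≤g zero c+f≤g = ≤-respˡ-≈ (+-assoc _ _ _) (+-mono-≤ c+f≤g (sum-mono-≤ (f≤g ∘ suc)))
  term+sum≤sum {f = f} {g} f≤g {c} (suc i) c+f≤g = begin
    c + (f zero + sum (f ∘ suc)) ≈⟨ solve 3 (λ a b c → a :+ (b :+ c) := b :+ (a :+ c)) refl c (f zero) _ ⟩
    f zero + (c + sum (f ∘ suc)) ≤⟨ +-mono-≤ (f≤g zero) (term+sum≤sum (f≤g ∘ suc) i c+f≤g) ⟩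
    g zero + sum (g ∘ suc)       ∎

  sum-single : ∀ {n} (f : Fin n → Carrier) i → (∀ j → j ≢ i → f j ≈ 0#) → sum f ≈ f i
  sum-single {suc n} f zero f≈0 =
    trans (+-congˡ (trans (sum-cong-≋ (λ j → f≈0 (suc j) (λ ()))) (sum-replicate-zero n))) (+-identityʳ _)
  sum-single f (suc i) f≈0 =
    trans (+-cong (f≈0 zero (λ ())) (sum-single (f ∘ suc) i (λ j j≢i → f≈0 (suc j) (λ { ≡.refl → j≢i ≡.refl }))))
          (+-identityˡ _)

  -- Infima and the Archimedean property

  infimum : (P : Carrier → Set) → ∃ P → ∃ (LowerBound _≤_ P) → ∃ (IsInfimum _≤_ P)
  infimum P (x , Px) (b , b≤P) = - m , lower , greatest
    where
    -P : Carrier → Set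
    -P s = ∃ λ t → P t × s ≈ - t

    sup = complete -P (- x , x , Px , refl)
                   (- b , λ { s (t , Pt , s≈-t) → ≤-respˡ-≈ (sym s≈-t) (neg-antimono-≤ (b≤P t Pt)) })
    m = proj₁ sup

    lower : LowerBound _≤_ P (- m)
    lower t Pt = ≤-respʳ-≈ (-‿involutive t) (neg-antimono-≤ (proj₁ (proj₂ sup) (- t) (t , Pt , refl)))

    greatest : ∀ c → LowerBound _≤_ P c → c ≤ - m
    greatest c c≤P = ≤-respˡ-≈ (-‿involutive c) (neg-antimono-≤
      (proj₂ (proj₂ sup) (- c) λ { s (t , Pt , s≈-t) → ≤-respˡ-≈ (sym s≈-t) (neg-antimono-≤ (c≤P t Pt)) }))

  -- The multiples `N · a` are bounded below by `- b`, so they have an infimum m. As m also bounds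
  -- every `suc N · a`, the number m - a is again a lower bound, whence m - a ≤ m.
  archimedean : ∀ a b → (∀ N → 0# ≤ N · a + b) → 0# ≤ a
  archimedean a b 0≤Na+b = ≤-respʳ-≈ (-‿involutive a) (≤-respˡ-≈ -0#≈0# (neg-antimono-≤ -a≤0))
    where
    inf = infimum (λ x → ∃ λ N → x ≈ N · a) (0# , 0 , refl)
                  (- b , λ { x (N , x≈Na) → ≤-respʳ-≈ (sym x≈Na) (≤-respˡ-≈ (+-identityˡ _) (x≤y+z⇒x-z≤y (0≤Na+b N))) })
    m = proj₁ inf

    m-a-lower : LowerBound _≤_ (λ x → ∃ λ N → x ≈ N · a) (m - a)
    m-a-lower x (N , x≈Na) = x≤y+z⇒x-z≤y
      (proj₁ (proj₂ inf) (x + a) (suc N , trans (+-congʳ x≈Na) (+-comm (N · a) a)))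

    -a≤0 : - a ≤ 0#
    -a≤0 = +-cancelˡ-≤ m (≤-respʳ-≈ (sym (+-identityʳ m)) (proj₂ (proj₂ inf) (m - a) m-a-lower))

  -- Linear forms and Fourier-Motzkin elimination

  infixl 6 _⊕_
  infixr 7 _⊙_

  -- σ and τ are parameters: the scale of a linear system and its error.
  data Form (k : ℕ) : Set where
    var : Fin k → Form k
    σ τ : Form k
    _⊕_ : Form k → Form k → Form k
    _⊙_ : Carrier → Form k → Form k

  eval : ∀ {k} → Form k → Carrier → Carrier → V.Vector Carrier k → Carrier
  eval (var i) s t Y = Y i
  eval σ       s t Y = s
  eval τ       s t Y = t
  eval (e ⊕ f) s t Y = eval e s t Y + eval f s t Y
  eval (a ⊙ e) s t Y = a * eval e s t Y

  ⨁ : ∀ {m k} → (Fin m → Form k) → Form k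
  ⨁ {zero}  e = 0# ⊙ σ
  ⨁ {suc m} e = e zero ⊕ ⨁ (e ∘ suc)

  eval-⨁ : ∀ {m k} (e : Fin m → Form k) s t Y → eval (⨁ e) s t Y ≈ sum (λ i → eval (e i) s t Y)
  eval-⨁ {zero}  e s t Y = zeroˡ s
  eval-⨁ {suc m} e s t Y = +-congˡ (eval-⨁ (e ∘ suc) s t Y)

  headCoeff : ∀ {k} → Form (suc k) → Carrier
  headCoeff (var zero)    = 1#
  headCoeff (var (suc i)) = 0#
  headCoeff σ             = 0#
  headCoeff τ             = 0#
  headCoeff (e ⊕ f)       = headCoeff e + headCoeff f
  headCoeff (a ⊙ e)       = a * headCoeff e

  tailForm : ∀ {k} → Form (suc k) → Form k
  tailForm (var zero)    = 0# ⊙ σ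
  tailForm (var (suc i)) = var i
  tailForm σ             = σ
  tailForm τ             = τ
  tailForm (e ⊕ f)       = tailForm e ⊕ tailForm f
  tailForm (a ⊙ e)       = a ⊙ tailForm e

  eval-split : ∀ {k} (e : Form (suc k)) s t Y →
               eval e s t Y ≈ headCoeff e * V.head Y + eval (tailForm e) s t (V.tail Y)
  eval-split (var zero) s t Y =
    solve 2 (λ x s → x := con 1 :* x :+ con 0 :* s) refl (Y zero) s
  eval-split (var (suc i)) s t Y =
    solve 2 (λ y x → y := con 0 :* x :+ y) refl (Y (suc i)) (Y zero)
  eval-split σ s t Y = solve 2 (λ y x → y := con 0 :* x :+ y) refl s (Y zero)
  eval-split τ s t Y = solve 2 (λ y x → y := con 0 :* x :+ y) refl t (Y zero)
  eval-split (e ⊕ f) s t Y = trans (+-cong (eval-split e s t Y) (eval-split f s t Y))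
    (solve 5 (λ a b x e f → (a :* x :+ e) :+ (b :* x :+ f) := (a :+ b) :* x :+ (e :+ f))
      refl (headCoeff e) (headCoeff f) (Y zero) _ _)
  eval-split (a ⊙ e) s t Y = trans (*-congˡ (eval-split e s t Y))
    (solve 4 (λ a h x e → a :* (h :* x :+ e) := a :* h :* x :+ a :* e) refl a (headCoeff e) (Y zero) _)

  Sat : ∀ {k} → List (Form k) → Carrier → Carrier → V.Vector Carrier k → Set
  Sat S s t Y = All (λ e → 0# ≤ eval e s t Y) S

  record Bounds {k} (S L U : List (Form k)) (s t x : Carrier) (Y : V.Vector Carrier k) : Set where
    constructor bounds
    field
      free  : Sat S s t Y
      lower : All (λ e → eval e s t Y ≤ x) L
      upper : All (λ e → x ≤ eval e s t Y) U

  -x≤y⇒0≤y+x : ∀ {x y} → - x ≤ y → 0# ≤ y + x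
  -x≤y⇒0≤y+x {x} {y} -x≤y = ≤-respˡ-≈ (-‿inverseˡ x) (+-monoˡ-≤ x -x≤y)

  0≤y+x⇒-x≤y : ∀ {x y} → 0# ≤ y + x → - x ≤ y
  0≤y+x⇒-x≤y {x} {y} 0≤y+x = ≤-respˡ-≈ (+-identityˡ (- x)) (x≤y+z⇒x-z≤y 0≤y+x)

  inverse-nonNeg : ∀ {a b} → 0# ≤ a → a * b ≈ 1# → 0# ≤ b
  inverse-nonNeg {a} {b} 0≤a ab≈1 with total 0# b
  ... | inj₁ 0≤b = 0≤b
  ... | inj₂ b≤0 = contradiction (antisym 0≤1 (begin
    1#     ≈⟨ ab≈1 ⟨
    a * b  ≤⟨ *-monoˡ-≤ 0≤a b≤0 ⟩
    a * 0# ≈⟨ zeroʳ a ⟩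
    0#     ∎)) 0≉1

  cancelInverse : ∀ {a b} → a * b ≈ 1# → ∀ x → b * (a * x) ≈ x
  cancelInverse {a} {b} ab≈1 x = trans (sym (*-assoc b a x))
    (trans (*-congʳ (trans (*-comm b a) ab≈1)) (*-identityˡ x))

  solveLower : ∀ {a b x r} → 0# ≤ a → a * b ≈ 1# → 0# ≤ a * x + r → - b * r ≤ x
  solveLower {a} {b} {x} {r} 0≤a ab≈1 0≤ax+r = begin
    - b * r     ≈⟨ -‿distribˡ-* b r ⟨
    - (b * r)   ≤⟨ 0≤y+x⇒-x≤y (begin
      0#                ≤⟨ *-nonNeg (inverse-nonNeg 0≤a ab≈1) 0≤ax+r ⟩
      b * (a * x + r)   ≈⟨ trans (distribˡ b _ r) (+-congʳ (cancelInverse ab≈1 x)) ⟩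
      x + b * r         ∎) ⟩
    x ∎

  unsolveLower : ∀ {a b x r} → 0# ≤ a → a * b ≈ 1# → - b * r ≤ x → 0# ≤ a * x + r
  unsolveLower {a} {b} {x} {r} 0≤a ab≈1 -br≤x = begin
    0#                 ≤⟨ *-nonNeg 0≤a (-x≤y⇒0≤y+x (≤-respˡ-≈ (sym (-‿distribˡ-* b r)) -br≤x)) ⟩
    a * (x + b * r)    ≈⟨ trans (distribˡ a x _) (+-congˡ (cancelInverse (trans (*-comm b a) ab≈1) r)) ⟩
    a * x + r          ∎

  neg*neg : ∀ {a b} → a * b ≈ 1# → - a * - b ≈ 1#
  neg*neg {a} {b} ab≈1 = trans (sym (-‿distribˡ-* a (- b))) (trans (-‿cong (sym (-‿distribʳ-* a b)))
    (trans (-‿involutive (a * b)) ab≈1))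

  solveUpper : ∀ {a b x r} → a ≤ 0# → a * b ≈ 1# → 0# ≤ a * x + r → x ≤ - b * r
  solveUpper {a} {b} {x} {r} a≤0 ab≈1 0≤ax+r = begin
    x               ≈⟨ cancelInverse -a*-b≈1 x ⟨
    - b * (- a * x) ≤⟨ *-monoˡ-≤ (inverse-nonNeg 0≤-a -a*-b≈1) (begin
      - a * x   ≈⟨ -‿distribˡ-* a x ⟨
      - (a * x) ≤⟨ 0≤y+x⇒-x≤y (≤-respʳ-≈ (+-comm _ r) 0≤ax+r) ⟩
      r         ∎) ⟩
    - b * r         ∎
    where
    -a*-b≈1 = neg*neg ab≈1
    0≤-a = ≤-respˡ-≈ -0#≈0# (neg-antimono-≤ a≤0)

  unsolveUpper : ∀ {a b x r} → a ≤ 0# → a * b ≈ 1# → x ≤ - b * r → 0# ≤ a * x + r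
  unsolveUpper {a} {b} {x} {r} a≤0 ab≈1 x≤-br = ≤-respʳ-≈ (+-comm r _) (-x≤y⇒0≤y+x (begin
    - (a * x)       ≈⟨ -‿distribˡ-* a x ⟩
    - a * x         ≤⟨ *-monoˡ-≤ 0≤-a x≤-br ⟩
    - a * (- b * r) ≈⟨ cancelInverse (trans (*-comm (- b) (- a)) (neg*neg ab≈1)) r ⟩
    r               ∎))
    where
    0≤-a = ≤-respˡ-≈ -0#≈0# (neg-antimono-≤ a≤0)

  record HeadSolved {k} (S : List (Form (suc k))) : Set where
    field
      {free lower upper} : List (Form k)
      to   : ∀ {s t Y} → Sat S s t Y → Bounds free lower upper s t (V.head Y) (V.tail Y)
      from : ∀ {s t Y} → Bounds free lower upper s t (V.head Y) (V.tail Y) → Sat S s t Y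

  -- Each form is sorted by the sign of its head coefficient, which the decidable order determines:
  -- zero makes it free of the head variable, positive a lower bound on it, negative an upper bound.
  solveHead : ∀ {k} (S : List (Form (suc k))) → HeadSolved S
  solveHead [] = record { free = [] ; lower = [] ; upper = [] ; to = λ _ → bounds [] [] [] ; from = λ _ → [] }
  solveHead (e ∷ S) with headCoeff e ≤? 0# | 0# ≤? headCoeff e
  ... | yes a≤0 | yes 0≤a = record
    { free = tailForm e ∷ free
    ; to   = λ { {s} {t} {Y} (p ∷ ps) → let bounds f l u = to ps in
        bounds (≤-respʳ-≈ (split s t Y) p ∷ f) l u }
    ; from = λ { {s} {t} {Y} (bounds (p ∷ f) l u) → ≤-respʳ-≈ (sym (split s t Y)) p ∷ from (bounds f l u) }
    }
    where
    open HeadSolved (solveHead S)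
    split : ∀ s t Y → eval e s t Y ≈ eval (tailForm e) s t (V.tail Y)
    split s t Y = trans (eval-split e s t Y)
      (trans (+-congʳ (trans (*-congʳ (antisym a≤0 0≤a)) (zeroˡ _))) (+-identityˡ _))
  ... | no a≰0 | yes 0≤a = record
    { lower = (- b ⊙ tailForm e) ∷ lower
    ; to   = λ { {s} {t} {Y} (p ∷ ps) → let bounds f l u = to ps in
        bounds f (solveLower 0≤a ab≈1 (≤-respʳ-≈ (eval-split e s t Y) p) ∷ l) u }
    ; from = λ { {s} {t} {Y} (bounds f (p ∷ l) u) →
        ≤-respʳ-≈ (sym (eval-split e s t Y)) (unsolveLower 0≤a ab≈1 p) ∷ from (bounds f l u) }
    }
    where
    open HeadSolved (solveHead S)
    inv = inverse (headCoeff e) (a≰0 ∘ ≤-reflexive)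
    b = proj₁ inv
    ab≈1 = proj₂ inv
  ... | _ | no 0≰a = record
    { upper = (- b ⊙ tailForm e) ∷ upper
    ; to   = λ { {s} {t} {Y} (p ∷ ps) → let bounds f l u = to ps in
        bounds f l (solveUpper a≤0 ab≈1 (≤-respʳ-≈ (eval-split e s t Y) p) ∷ u) }
    ; from = λ { {s} {t} {Y} (bounds f l (p ∷ u)) →
        ≤-respʳ-≈ (sym (eval-split e s t Y)) (unsolveUpper a≤0 ab≈1 p) ∷ from (bounds f l u) }
    }
    where
    open HeadSolved (solveHead S)
    a≤0 = [ (λ 0≤a → contradiction 0≤a 0≰a) , id ]′ (total 0# (headCoeff e))
    inv = inverse (headCoeff e) (0≰a ∘ ≤-reflexive ∘ sym)
    b = proj₁ inv
    ab≈1 = proj₂ inv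

  -- The default 0 is first lowered below every upper bound and then raised above every lower bound;
  -- raising cannot overshoot, because each lower bound is below all upper ones. This also covers
  -- empty lists.
  between : ∀ {A : Set} (val : A → Carrier) (L U : List A) →
            All (λ l → All (λ u → val l ≤ val u) U) L →
            ∃ λ x → All (λ l → val l ≤ x) L × All (λ u → x ≤ val u) U
  between val [] [] L≤U = 0# , [] , []
  between val [] (u ∷ U) L≤U with between val [] U []
  ... | x , _ , x≤U = val u ⊓ x , [] , x⊓y≤x (val u) x ∷ All.map (≤-trans (x⊓y≤y (val u) x)) x≤U
  between val (l ∷ L) U (l≤U ∷ L≤U) with between val L U L≤U
  ... | x , L≤x , x≤U =
    val l ⊔ x
    , x≤x⊔y (val l) x ∷ All.map (λ p → ≤-trans p (x≤y⊔x (val l) x)) L≤x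
    , All.zipWith (λ (p , q) → ⊔-lub p q) (l≤U , x≤U)

  infixl 6 _⊖_

  _⊖_ : ∀ {k} → Form k → Form k → Form k
  e ⊖ f = e ⊕ (- 1# ⊙ f)

  eval-⊖ : ∀ {k} (e f : Form k) s t Y → eval (e ⊖ f) s t Y ≈ eval e s t Y - eval f s t Y
  eval-⊖ e f s t Y = +-congˡ (trans (sym (-‿distribˡ-* 1# _)) (-‿cong (*-identityˡ _)))

  -- The reduced system is chosen before s and t, since the same one has to receive the approximate
  -- solutions at every scale and return the exact solution at scale 1 and error 0.
  eliminate : ∀ {k} (S : List (Form (suc k))) → ∃ λ (S′ : List (Form k)) → ∀ {s t} →
              (∀ {Y} → Sat S s t Y → Sat S′ s t (V.tail Y)) ×
              (∀ {Y} → Sat S′ s t Y → ∃ λ x → Sat S s t (x V.∷ Y))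
  eliminate S = free ++ pairs , project , lift
    where
    open HeadSolved (solveHead S)
    pairs = cartesianProductWith (λ l u → u ⊖ l) lower upper

    project : ∀ {s t Y} → Sat S s t Y → Sat (free ++ pairs) s t (V.tail Y)
    project {s} {t} {Y} sat = ++⁺ f (All.tabulate pair)
      where
      open Bounds (to sat) renaming (free to f; lower to l≤; upper to ≤u)
      pair : ∀ {e} → e ∈ pairs → 0# ≤ eval e s t (V.tail Y)
      pair e∈ with ∈-cartesianProductWith⁻ (λ l u → u ⊖ l) lower upper e∈
      ... | l , u , l∈ , u∈ , ≡.refl = ≤-respʳ-≈ (sym (eval-⊖ u l s t (V.tail Y)))
        (x≤y⇒0≤y-x (≤-trans (All.lookup l≤ l∈) (All.lookup ≤u u∈)))

    lift : ∀ {s t Y} → Sat (free ++ pairs) s t Y → ∃ λ x → Sat S s t (x V.∷ Y)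
    lift {s} {t} {Y} sat =
      let x , L≤x , x≤U = between (λ e → eval e s t Y) lower upper
            (All.tabulate λ {l} l∈ → All.tabulate λ {u} u∈ → 0≤y-x⇒x≤y (≤-respʳ-≈ (eval-⊖ u l s t Y)
              (All.lookup (++⁻ʳ free sat) (∈-cartesianProductWith⁺ (λ l u → u ⊖ l) l∈ u∈))))
      in x , from (bounds (++⁻ˡ free sat) L≤x x≤U)

  σ-coeff τ-coeff : Form 0 → Carrier
  σ-coeff σ       = 1#
  σ-coeff τ       = 0#
  σ-coeff (e ⊕ f) = σ-coeff e + σ-coeff f
  σ-coeff (a ⊙ e) = a * σ-coeff e
  τ-coeff σ       = 0#
  τ-coeff τ       = 1#
  τ-coeff (e ⊕ f) = τ-coeff e + τ-coeff f
  τ-coeff (a ⊙ e) = a * τ-coeff e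

  -- Without variables, a constraint at scale N and error 1 says that N · a + b is nonnegative, and
  -- at scale 1 and error 0 that a is: exactly the hypothesis and conclusion of `archimedean`.
  eval-closed : ∀ e s t Y → eval e s t Y ≈ σ-coeff e * s + τ-coeff e * t
  eval-closed σ s t Y = solve 2 (λ s t → s := con 1 :* s :+ con 0 :* t) refl s t
  eval-closed τ s t Y = solve 2 (λ s t → t := con 0 :* s :+ con 1 :* t) refl s t
  eval-closed (e ⊕ f) s t Y = trans (+-cong (eval-closed e s t Y) (eval-closed f s t Y))
    (solve 6 (λ a b c d s t → a :* s :+ b :* t :+ (c :* s :+ d :* t) := (a :+ c) :* s :+ (b :+ d) :* t)
      refl (σ-coeff e) (τ-coeff e) (σ-coeff f) (τ-coeff f) s t)
  eval-closed (a ⊙ e) s t Y = trans (*-congˡ (eval-closed e s t Y))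
    (solve 5 (λ a b c s t → a :* (b :* s :+ c :* t) := a :* b :* s :+ a :* c :* t)
      refl a (σ-coeff e) (τ-coeff e) s t)

  -- The averages of solutions at scale N and error 1 have error 1/N; elimination keeps this form.
  Sat-limit : ∀ {k} (S : List (Form k)) → (∀ N → ∃ (Sat S (N · 1#) 1#)) → ∃ (Sat S 1# 0#)
  Sat-limit {zero} S approx = (λ ()) , All.tabulate λ {e} e∈ →
    ≤-respʳ-≈ (sym (trans (eval-closed e 1# 0# (λ ()))
                          (solve 2 (λ a b → a :* con 1 :+ b :* con 0 := a) refl (σ-coeff e) (τ-coeff e))))
      (archimedean (σ-coeff e) (τ-coeff e) λ N → let Y , sat = approx N in
        ≤-respʳ-≈ (trans (eval-closed e (N · 1#) 1# Y)
                         (+-cong (N·1 N (σ-coeff e)) (*-identityʳ _)))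
          (All.lookup sat e∈))
    where
    N·1 : ∀ N a → a * (N · 1#) ≈ N · a
    N·1 N a = trans (×-comm-* N a 1#) (×-congʳ N (*-identityʳ a))
  Sat-limit {suc k} S approx =
    let S′ , elim = eliminate S
        Y , sat = Sat-limit S′ λ N → let Y , sat = approx N in V.tail Y , proj₁ elim {Y = Y} sat
        x , sat′ = proj₂ elim sat
    in x V.∷ Y , sat′

  -- Constraint systems presented by linear forms

  System : ℕ → Set₁
  System k = Carrier → Carrier → V.Vector Carrier k → Set

  -- One list of forms represents the predicate for all s, t and Y at once. Constraints can then be
  -- written as ordinary inequalities and be reflected into syntax only where `limit` is applied.
  Linear : ∀ {k} → System k → Set
  Linear {k} P = ∃ λ (S : List (Form k)) → ∀ s t Y → (P s t Y → Sat S s t Y) × (Sat S s t Y → P s t Y)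

  limit : ∀ {k} {P : System k} → Linear P → (∀ N → ∃ (P (N · 1#) 1#)) → ∃ (P 1# 0#)
  limit (S , P⇔S) approx =
    let Y , sat = Sat-limit S (λ N → let Y , p = approx N in Y , proj₁ (P⇔S _ _ Y) p)
    in Y , proj₂ (P⇔S _ _ Y) sat

  linear-≤ : ∀ {k} (e f : Form k) → Linear (λ s t Y → eval e s t Y ≤ eval f s t Y)
  linear-≤ e f = [ f ⊖ e ] , λ s t Y →
      (λ e≤f → ≤-respʳ-≈ (sym (eval-⊖ f e s t Y)) (x≤y⇒0≤y-x e≤f) ∷ [])
    , (λ { (p ∷ []) → 0≤y-x⇒x≤y (≤-respʳ-≈ (eval-⊖ f e s t Y) p) })

  linear-× : ∀ {k} {P Q : System k} → Linear P → Linear Q → Linear (λ s t Y → P s t Y × Q s t Y)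
  linear-× (S , P⇔S) (T , Q⇔T) = S ++ T , λ s t Y →
      (λ (p , q) → ++⁺ (proj₁ (P⇔S s t Y) p) (proj₁ (Q⇔T s t Y) q))
    , (λ sat → proj₂ (P⇔S s t Y) (++⁻ˡ S sat) , proj₂ (Q⇔T s t Y) (++⁻ʳ S sat))

  linear-∀ : ∀ {m k} {P : Fin m → System k} → (∀ i → Linear (P i)) → Linear (λ s t Y → ∀ i → P i s t Y)
  linear-∀ P = concat (tabulate (proj₁ ∘ P)) , λ s t Y →
      (λ p → concat⁺ (tabulate⁺ (λ i → proj₁ (proj₂ (P i) s t Y) (p i))))
    , (λ sat i → proj₂ (proj₂ (P i) s t Y) (tabulate⁻ (concat⁻ sat) i))

  -- Positions from averaged iteration

  module Assignment {n h : ℕ}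
    (A : Fin n → Fin n → Carrier)
    (A≥0 : ∀ u v → 0# ≤ A u v)
    (ΣA≤1 : ∀ v → sum (λ u → A u v) ≤ 1#)
    (U : Fin n → Fin (suc h) → Carrier)
    (U≥0 : ∀ v i → 0# ≤ U v i)
    (U-first : ∀ v → 1# ≤ U v zero)
    (U-step : ∀ u v i → U u (inject₁ i) + A u v ≤ 1# + U v (suc i))
    (U-last : ∀ u v → U u (fromℕ h) + A u v ≤ 1#)
    where

    -- Only positions 1 to H = h + 1 are represented, so index `zero` is position 1 and `fromℕ h` is
    -- position H.
    Assign : Set
    Assign = Fin n → Fin (suc h) → Carrier

    -- `first` stands for the link from the root: combined with X1 it yields x root v ≤ y v zero.
    record IsAssignment (y : Assign) : Set where
      field
        step  : ∀ u v i → y u (inject₁ i) + A u v ≤ 1# + y v (suc i)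
        last  : ∀ u v → y u (fromℕ h) + A u v ≤ 1#
        first : ∀ v → 1# ≤ y v zero + sum (λ u → A u v)
        sum≈1 : ∀ v → sum (y v) ≈ 1#
        y≥0   : ∀ v i → 0# ≤ y v i

    -- These properties hold exactly at each point of the orbit. The step inequality is absent
    -- because it compares y with `next y`, not y with itself.
    record Valid (y : Assign) : Set where
      field
        y≥0   : ∀ v i → 0# ≤ y v i
        y≤U   : ∀ v i → y v i ≤ U v i
        sum≈1 : ∀ v → sum (y v) ≈ 1#
        first : ∀ v → 1# ≤ y v zero + sum (λ u → A u v)

      y≤1 : ∀ v i → y v i ≤ 1#
      y≤1 v i = ≤-respʳ-≈ (sum≈1 v) (term≤sum (y≥0 v) i)

    inflow : Assign → Fin n → Fin h → Carrier
    inflow y v i = sum λ u → A u v * y u (inject₁ i)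

    next : Assign → Assign
    next y v (suc i) = U v (suc i) ⊓ inflow y v i
    next y v zero    = 1# - sum λ i → U v (suc i) ⊓ inflow y v i

    module _ {y : Assign} (valid : Valid y) where
      open Valid valid

      A*y≥0 : ∀ u v i → 0# ≤ A u v * y u i
      A*y≥0 u v i = *-nonNeg (A≥0 u v) (y≥0 u i)

      -- Both arguments of the minimum are large enough: the cap since y ≤ U and `U` satisfies the
      -- same inequality, the inflow since the product A u v · y u i is one of its terms.
      next-step : ∀ u v i → y u (inject₁ i) + A u v ≤ 1# + next y v (suc i)
      next-step u v i = ≤-respʳ-≈ (sym (mono-≤-distrib-⊓ +-congˡ (+-monoʳ-≤ 1#) (U v (suc i)) (inflow y v i)))
        (⊓-glb (≤-trans (+-monoˡ-≤ (A u v) (y≤U u (inject₁ i))) (U-step u v i)) (begin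
          y u (inject₁ i) + A u v      ≈⟨ +-comm _ _ ⟩
          A u v + y u (inject₁ i)      ≤⟨ x+y≤1+xy A≤1 (y≤1 u (inject₁ i)) ⟩
          1# + A u v * y u (inject₁ i) ≤⟨ +-monoʳ-≤ 1# (term≤sum (λ u → A*y≥0 u v (inject₁ i)) u) ⟩
          1# + inflow y v i            ∎))
        where
        A≤1 : A u v ≤ 1#
        A≤1 = ≤-trans (term≤sum (λ u → A≥0 u v) u) (ΣA≤1 v)

      -- After exchanging the sums, each u sends along its arc at most its total mass 1, the mass at
      -- the last position not being forwarded. This makes the remainder at position 1 nonnegative
      -- and gives `first`.
      Σ-next≤ΣA : ∀ v → sum (λ i → next y v (suc i)) ≤ sum (λ u → A u v)
      Σ-next≤ΣA v = begin
        sum (λ i → next y v (suc i))                       ≤⟨ sum-mono-≤ (λ i → x⊓y≤y (U v (suc i)) (inflow y v i)) ⟩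
        sum (λ i → sum λ u → A u v * y u (inject₁ i))      ≈⟨ ∑-comm (λ i u → A u v * y u (inject₁ i)) ⟩
        sum (λ u → sum λ i → A u v * y u (inject₁ i))      ≈⟨ sum-cong-≋ (λ u → *-distribˡ-sum (A u v) (y u ∘ inject₁)) ⟨
        sum (λ u → A u v * sum (y u ∘ inject₁))            ≤⟨ sum-mono-≤ (λ u → *-monoˡ-≤ (A≥0 u v) (init≤1 u)) ⟩
        sum (λ u → A u v * 1#)                             ≈⟨ sum-cong-≋ (λ u → *-identityʳ (A u v)) ⟩
        sum (λ u → A u v)                                  ∎
        where
        init≤1 : ∀ u → sum (y u ∘ inject₁) ≤ 1#
        init≤1 u = begin
          sum (y u ∘ inject₁)                ≤⟨ x≤x+y _ (y≥0 u (fromℕ h)) ⟩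
          sum (y u ∘ inject₁) + y u (fromℕ h) ≈⟨ sum-init-last (y u) ⟨
          sum (y u)                          ≈⟨ sum≈1 u ⟩
          1#                                 ∎

      next-suc≥0 : ∀ v i → 0# ≤ next y v (suc i)
      next-suc≥0 v i = ⊓-glb (U≥0 v (suc i)) (sum-nonNeg (λ u → A*y≥0 u v (inject₁ i)))

      next-valid : Valid (next y)
      next-valid = record
        { y≥0   = λ { v zero    → x≤y⇒0≤y-x (≤-trans (Σ-next≤ΣA v) (ΣA≤1 v))
                    ; v (suc i) → next-suc≥0 v i }
        ; y≤U   = λ { v zero    → ≤-trans (x≤y+z⇒x-z≤y (x≤x+y 1# (sum-nonNeg (next-suc≥0 v)))) (U-first v)
                    ; v (suc i) → x⊓y≤x (U v (suc i)) (inflow y v i) }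
        ; sum≈1 = λ v → x-z+z≈x 1# _
        ; first = λ v → begin
            1#                                             ≈⟨ x-z+z≈x 1# _ ⟨
            next y v zero + sum (λ i → next y v (suc i))   ≤⟨ +-monoʳ-≤ _ (Σ-next≤ΣA v) ⟩
            next y v zero + sum (λ u → A u v)              ∎
        }

    -- The iteration starts with all mass at position 1, where `U-first` provides the capacity.
    orbit : ℕ → Assign
    orbit zero v zero    = 1#
    orbit zero v (suc i) = 0#
    orbit (suc t)        = next (orbit t)

    orbit-valid : ∀ t → Valid (orbit t)
    orbit-valid zero = record
      { y≥0   = λ { v zero → 0≤1 ; v (suc i) → ≤-refl }
      ; y≤U   = λ { v zero → U-first v ; v (suc i) → U≥0 v (suc i) }
      ; sum≈1 = λ v → trans (+-congˡ (sum-replicate-zero h)) (+-identityʳ 1#)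
      ; first = λ v → x≤x+y 1# (sum-nonNeg (λ u → A≥0 u v))
      }
    orbit-valid (suc t) = next-valid (orbit-valid t)

    partialSum : ℕ → Assign
    partialSum zero    v i = 0#
    partialSum (suc N) v i = orbit N v i + partialSum N v i

    *-suc· : ∀ a N → a * (suc N · 1#) ≈ a + a * (N · 1#)
    *-suc· a N = trans (distribˡ a 1# (N · 1#)) (+-congʳ (*-identityʳ a))

    -- Summing `next-step` shifts the right-hand orbit by one, so besides the partial sum only the
    -- term of `orbit N` is left over. It is at most 1 whatever N is, which is the error τ.
    partialSum-step : ∀ N u v i → partialSum N u (inject₁ i) + A u v * (N · 1#)
                                  ≤ N · 1# + partialSum N v (suc i) + orbit N v (suc i)
    partialSum-step zero u v i = begin
      0# + A u v * 0#                ≈⟨ solve 1 (λ a → con 0 :+ a :* con 0 := con 0) refl (A u v) ⟩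
      0#                             ≤⟨ Valid.y≥0 (orbit-valid zero) v (suc i) ⟩
      orbit zero v (suc i)           ≈⟨ solve 1 (λ a → a := con 0 :+ con 0 :+ a) refl _ ⟩
      0# + 0# + orbit zero v (suc i) ∎
    partialSum-step (suc N) u v i = begin
      y + Y + A u v * (suc N · 1#)           ≈⟨ +-congˡ (*-suc· (A u v) N) ⟩
      (y + Y) + (A u v + A u v * (N · 1#))   ≈⟨ interchange y Y _ _ ⟩
      (y + A u v) + (Y + A u v * (N · 1#))   ≤⟨ +-mono-≤ (next-step (orbit-valid N) u v i) (partialSum-step N u v i) ⟩
      (1# + y″) + (N · 1# + Y′ + y′)         ≈⟨ solve 5 (λ o a b c d → (o :+ a) :+ (b :+ c :+ d) := (o :+ b) :+ (d :+ c) :+ a)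
                                                   refl 1# y″ (N · 1#) Y′ y′ ⟩
      suc N · 1# + (y′ + Y′) + y″             ∎
      where
      y = orbit N u (inject₁ i)
      Y = partialSum N u (inject₁ i)
      y′ = orbit N v (suc i)
      Y′ = partialSum N v (suc i)
      y″ = orbit (suc N) v (suc i)

    partialSum-last : ∀ N u v → partialSum N u (fromℕ h) + A u v * (N · 1#) ≤ N · 1#
    partialSum-last zero u v = ≤-reflexive (solve 1 (λ a → con 0 :+ a :* con 0 := con 0) refl (A u v))
    partialSum-last (suc N) u v = begin
      orbit N u (fromℕ h) + partialSum N u (fromℕ h) + A u v * (suc N · 1#)           ≈⟨ +-congˡ (*-suc· (A u v) N) ⟩
      orbit N u (fromℕ h) + partialSum N u (fromℕ h) + (A u v + A u v * (N · 1#))     ≈⟨ interchange _ _ _ _ ⟩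
      (orbit N u (fromℕ h) + A u v) + (partialSum N u (fromℕ h) + A u v * (N · 1#))   ≤⟨ +-mono-≤
        (≤-trans (+-monoˡ-≤ _ (Valid.y≤U (orbit-valid N) u (fromℕ h))) (U-last u v)) (partialSum-last N u v) ⟩
      suc N · 1#  ∎

    partialSum-first : ∀ N v → N · 1# ≤ partialSum N v zero + sum (λ u → A u v) * (N · 1#)
    partialSum-first zero v = ≤-reflexive (solve 1 (λ a → con 0 := con 0 :+ a :* con 0) refl _)
    partialSum-first (suc N) v = begin
      1# + N · 1#                              ≤⟨ +-mono-≤ (Valid.first (orbit-valid N) v) (partialSum-first N v) ⟩
      (y + a) + (Y + a * (N · 1#))             ≈⟨ interchange y a Y _ ⟩
      (y + Y) + (a + a * (N · 1#))             ≈⟨ +-congˡ (*-suc· a N) ⟨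
      (y + Y) + a * (suc N · 1#)               ∎
      where
      y = orbit N v zero
      Y = partialSum N v zero
      a = sum (λ u → A u v)

    partialSum-total : ∀ N v → sum (partialSum N v) ≈ N · 1#
    partialSum-total zero    v = sum-replicate-zero (suc h)
    partialSum-total (suc N) v = trans (∑-distrib-+ (orbit N v) (partialSum N v))
      (+-cong (Valid.sum≈1 (orbit-valid N) v) (partialSum-total N v))

    partialSum≥0 : ∀ N v i → 0# ≤ partialSum N v i
    partialSum≥0 zero    v i = ≤-refl
    partialSum≥0 (suc N) v i = +-nonNeg (Valid.y≥0 (orbit-valid N) v i) (partialSum≥0 N v i)

    varAt : Fin n → Fin (suc h) → Form (n ℕ.* suc h)
    varAt v i = var (combine v i)

    unflatten : V.Vector Carrier (n ℕ.* suc h) → Assign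
    unflatten Y v i = Y (combine v i)

    -- Homogenising by s admits partial sums at s = N, with no division by N. Only the step
    -- inequality carries the error t; the others hold exactly for the sums. Zero is written
    -- `0# * s` to match the form `0# ⊙ σ`.
    ScaledAssignment : System (n ℕ.* suc h)
    ScaledAssignment s t Y =
        (∀ u v i → y u (inject₁ i) + A u v * s ≤ s + y v (suc i) + t)
      × (∀ u v → y u (fromℕ h) + A u v * s ≤ s)
      × (∀ v → s ≤ y v zero + sum (λ u → A u v) * s)
      × (∀ v → eval (⨁ (varAt v)) s t Y ≤ s)
      × (∀ v → s ≤ eval (⨁ (varAt v)) s t Y)
      × (∀ v i → 0# * s ≤ y v i)
      where y = unflatten Y

    linear-ScaledAssignment : Linear ScaledAssignment
    linear-ScaledAssignment =
      linear-× (linear-∀ λ u → linear-∀ λ v → linear-∀ λ i →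
                  linear-≤ (y u (inject₁ i) ⊕ A u v ⊙ σ) (σ ⊕ y v (suc i) ⊕ τ))
      (linear-× (linear-∀ λ u → linear-∀ λ v → linear-≤ (y u (fromℕ h) ⊕ A u v ⊙ σ) σ)
      (linear-× (linear-∀ λ v → linear-≤ σ (y v zero ⊕ sum (λ u → A u v) ⊙ σ))
      (linear-× (linear-∀ λ v → linear-≤ (⨁ (y v)) σ)
      (linear-× (linear-∀ λ v → linear-≤ σ (⨁ (y v)))
                (linear-∀ λ v → linear-∀ λ i → linear-≤ (0# ⊙ σ) (y v i))))))
      where
      y = varAt

    flatten : Assign → V.Vector Carrier (n ℕ.* suc h)
    flatten y j = uncurry y (remQuot (suc h) j)

    module _ (N : ℕ) where
      Y = flatten (partialSum N)

      unflatten-flatten : ∀ v i → unflatten Y v i ≡ partialSum N v i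
      unflatten-flatten v i = ≡.cong (uncurry (partialSum N)) (remQuot-combine v i)

      sum-flatten : ∀ v → eval (⨁ (varAt v)) (N · 1#) 1# Y ≈ N · 1#
      sum-flatten v = trans (eval-⨁ (varAt v) (N · 1#) 1# Y)
        (trans (sum-cong-≋ (λ i → reflexive (unflatten-flatten v i))) (partialSum-total N v))

      step-flatten : ∀ u v i → unflatten Y u (inject₁ i) + A u v * (N · 1#) ≤ N · 1# + unflatten Y v (suc i) + 1#
      step-flatten u v i rewrite unflatten-flatten u (inject₁ i) | unflatten-flatten v (suc i) =
        ≤-trans (partialSum-step N u v i) (+-monoʳ-≤ _ (Valid.y≤1 (orbit-valid N) v (suc i)))

      last-flatten : ∀ u v → unflatten Y u (fromℕ h) + A u v * (N · 1#) ≤ N · 1#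
      last-flatten u v rewrite unflatten-flatten u (fromℕ h) = partialSum-last N u v

      first-flatten : ∀ v → N · 1# ≤ unflatten Y v zero + sum (λ u → A u v) * (N · 1#)
      first-flatten v rewrite unflatten-flatten v zero = partialSum-first N v

      nonNeg-flatten : ∀ v i → 0# * (N · 1#) ≤ unflatten Y v i
      nonNeg-flatten v i rewrite unflatten-flatten v i = ≤-respˡ-≈ (sym (zeroˡ _)) (partialSum≥0 N v i)

      flatten-scaled : ScaledAssignment (N · 1#) 1# Y
      flatten-scaled = step-flatten , last-flatten , first-flatten
        , (λ v → ≤-reflexive (sum-flatten v)) , (λ v → ≤-reflexive (sym (sum-flatten v))) , nonNeg-flatten

    scaled⇒assignment : ∀ {Y} → ScaledAssignment 1# 0# Y → IsAssignment (unflatten Y)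
    scaled⇒assignment {Y} (step , last , first , sum≤1 , sum≥1 , y≥0) = record
      { step  = λ u v i → begin
          unflatten Y u (inject₁ i) + A u v      ≈⟨ +-congˡ (*-identityʳ (A u v)) ⟨
          unflatten Y u (inject₁ i) + A u v * 1# ≤⟨ step u v i ⟩
          1# + unflatten Y v (suc i) + 0#        ≈⟨ +-identityʳ _ ⟩
          1# + unflatten Y v (suc i)             ∎
      ; last  = λ u v → ≤-respˡ-≈ (+-congˡ (*-identityʳ (A u v))) (last u v)
      ; first = λ v → ≤-respʳ-≈ (+-congˡ (*-identityʳ _)) (first v)
      ; sum≈1 = λ v → trans (sym (eval-⨁ (varAt v) 1# 0# Y)) (antisym (sum≤1 v) (sum≥1 v))
      ; y≥0   = λ v i → ≤-respˡ-≈ (zeroˡ 1#) (y≥0 v i)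
      }

    assignment : ∃ IsAssignment
    assignment =
      let Y , scaled = limit linear-ScaledAssignment (λ N → flatten (partialSum N) , flatten-scaled N)
      in unflatten Y , scaled⇒assignment scaled

  -- Conditional sums and the star as a feasible point

  open HMSTP ℝ hiding (_≈_; _+_; _*_; _-_; 0#; 1#; sum)

  if-yes : ∀ {P A : Set} (P? : Dec P) {a b : A} → P → (if does P? then a else b) ≡ a
  if-yes (yes _) p = ≡.refl
  if-yes (no ¬p) p = contradiction p ¬p

  if-no : ∀ {P A : Set} (P? : Dec P) {a b : A} → ¬ P → (if does P? then a else b) ≡ b
  if-no (yes p) ¬p = contradiction p ¬p
  if-no (no _)  ¬p = ≡.refl

  if-elim : ∀ {P A : Set} (P? : Dec P) (Q : A → Set) {a b : A} → (P → Q a) → (¬ P → Q b) → Q (if does P? then a else b)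
  if-elim (yes p) Q qa qb = qa p
  if-elim (no ¬p) Q qa qb = qb ¬p

  sumOver-nonNeg : ∀ {n} {P : Fin n → Set} (P? : Decidable P) {f} → (∀ i → P i → 0# ≤ f i) → 0# ≤ sumOver P? f
  sumOver-nonNeg P? 0≤f = sum-nonNeg λ i → if-elim (P? i) (0# ≤_) (0≤f i) (λ _ → ≤-refl)

  arcCost-nonNeg : ∀ I x → XConstraints I x → 0# ≤ arcCost I x
  arcCost-nonNeg I x xConstraints = sum-nonNeg λ u → sumOver-nonNeg (λ v → u <? v) λ v u<v →
    *-nonNeg (proj₁ (cost-pos u v (<⇒≢ u<v)))
             (+-nonNeg (proj₁ (X3 u v (<⇒≢ u<v))) (proj₁ (X3 v u (≢-sym (<⇒≢ u<v)))))
    where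
    open Instance I
    open XConstraints xConstraints

  1-0≈1 : 1# - 0# ≈ 1#
  1-0≈1 = trans (+-congˡ -0#≈0#) (+-identityʳ 1#)

  0∈[0,1] : InUnitInterval 0#
  0∈[0,1] = ≤-refl , 0≤1

  1∈[0,1] : InUnitInterval 1#
  1∈[0,1] = 0≤1 , ≤-refl

  module _ (I : Instance) where
    open Instance I

    indicator : Fin n → Carrier
    indicator v = if does (v ≟ root) then 1# else 0#

    indicator∈[0,1] : ∀ v → InUnitInterval (indicator v)
    indicator∈[0,1] v = if-elim (v ≟ root) InUnitInterval (λ _ → 1∈[0,1]) (λ _ → 0∈[0,1])

    -- The root is at position 0 and every other node, joined directly to it, at position 1. Here
    -- `l v i` is 1 when v lies before position i, and `g i v` is 1 when it lies after.
    starPoint : PPoint I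
    starPoint = record
      { x = λ u v → indicator u
      ; l = λ { v zero → 0# ; v (suc zero) → indicator v ; v (suc (suc i)) → 1# }
      ; g = λ { zero v → 1# - indicator v ; (suc i) v → 0# }
      }

    star-xConstraints : XConstraints I (PPoint.x starPoint)
    star-xConstraints = record
      { X1 = λ v → begin
          sumOver (λ u → ¬? (u ≟ v)) indicator                        ≤⟨ sum-mono-≤ (λ u → if-elim (¬? (u ≟ v)) (_≤ indicator u)
                                                                            (λ _ → ≤-refl) (λ _ → proj₁ (indicator∈[0,1] u))) ⟩
          sum indicator                                               ≈⟨ sum-indicator ⟩
          1#                                                          ∎
      ; X2 = λ v w v≢r w≢v → begin
          indicator v ≈⟨ reflexive (if-no (v ≟ root) v≢r) ⟩
          0#          ≤⟨ sumOver-nonNeg (λ u → ¬? (u ≟ v) ×-dec ¬? (u ≟ w)) (λ u _ → proj₁ (indicator∈[0,1] u)) ⟩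
          sumOver (λ u → ¬? (u ≟ v) ×-dec ¬? (u ≟ w)) indicator ∎
      ; X3 = λ u v _ → indicator∈[0,1] u
      ; X4 = λ v _ v≢r → begin
          1#            ≈⟨ sum-indicator ⟨
          sum indicator ≤⟨ sum-mono-≤ (λ u → if-elim (¬? (u ≟ v)) (indicator u ≤_) (λ _ → ≤-refl)
                             (λ ¬u≢v → ≤-reflexive (reflexive (if-no (u ≟ root) (λ u≡r → ¬u≢v (λ u≡v → v≢r (≡.trans (≡.sym u≡v) u≡r))))))) ⟩
          sumOver (λ u → ¬? (u ≟ v)) indicator ∎
      }
      where
      sum-indicator : sum indicator ≈ 1#
      sum-indicator = trans (sum-single indicator root (λ v v≢r → reflexive (if-no (v ≟ root) v≢r)))
                            (reflexive (if-yes (root ≟ root) ≡.refl))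

  star-feasible : ∀ I → PPolyhedron I (starPoint I)
  -- Matching on `H≥1` exposes H as a successor, so that `position₁` computes to `suc zero`.
  star-feasible I@(record { H≥1 = s≤s z≤n }) = record
    { xConstraints = star-xConstraints I
    ; l-root   = refl
    ; g-root   = trans (+-congˡ (-‿cong (reflexive (if-yes (root ≟ root) ≡.refl)))) (-‿inverseʳ 1#)
    ; l-first  = λ v v≢r → reflexive (if-no (v ≟ root) v≢r)
    ; g-last   = λ v v≢r → refl
    ; l-mono   = λ { v zero → proj₁ (indicator∈[0,1] I v)
                   ; v (suc zero) → proj₂ (indicator∈[0,1] I v)
                   ; v (suc (suc i)) → ≤-refl }
    ; g+l      = λ { v zero → x-z+z≈x 1# _ ; v (suc i) → +-identityˡ 1# }
    ; link     = λ u v u≢v i → if-elim (u ≟ root) (λ z → z ≤ l u i + g i v)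
                   (λ { ≡.refl → link-root v (≢-sym u≢v) i })
                   (λ _ → +-nonNeg (proj₁ (l-bounds u i)) (proj₁ (g-bounds v i)))
    ; l-bounds = l-bounds
    ; g-bounds = g-bounds
    }
    where
    open Instance I
    open PPoint (starPoint I)

    l-bounds : ∀ v i → InUnitInterval (l v i)
    l-bounds v zero          = 0∈[0,1]
    l-bounds v (suc zero)    = indicator∈[0,1] I v
    l-bounds v (suc (suc i)) = 1∈[0,1]

    g-bounds : ∀ v i → InUnitInterval (g i v)
    g-bounds v zero    = x≤y⇒0≤y-x (proj₂ (indicator∈[0,1] I v))
                       , x≤y+z⇒x-z≤y (x≤x+y 1# (proj₁ (indicator∈[0,1] I v)))
    g-bounds v (suc i) = 0∈[0,1]

    link-root : ∀ v → v ≢ root → ∀ i → 1# ≤ l root i + g i v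
    link-root v v≢r zero          = ≤-reflexive (sym (trans (+-identityˡ _)
      (trans (+-congˡ (-‿cong (reflexive (if-no (v ≟ root) v≢r)))) 1-0≈1)))
    link-root v v≢r (suc zero)    = ≤-reflexive (sym (trans (+-identityʳ _) (reflexive (if-yes (root ≟ root) ≡.refl))))
    link-root v v≢r (suc (suc i)) = ≤-reflexive (sym (+-identityʳ 1#))

  -- From P to A with the arc variables fixed

  shifted-≤ : ∀ {p q x} → p + x ≤ 1# + q → p - q + x ≤ 1#
  shifted-≤ {p} {q} {x} p+x≤1+q = begin
    p - q + x   ≈⟨ solve 3 (λ p q x → p :+ q :+ x := p :+ x :+ q) refl p (- q) x ⟩
    p + x - q   ≤⟨ x≤y+z⇒x-z≤y p+x≤1+q ⟩
    1#          ∎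

  P⇒A : ∀ I p → PPolyhedron I p → ∃ λ y → APolyhedron I (record { x = PPoint.x p ; y = y })
  P⇒A I@(record { H≥1 = s≤s {n = h} z≤n }) p feasible = y , record
    { xConstraints = xConstraints
    ; y-root-zero  = reflexive (if-yes (root ≟ root) ≡.refl)
    ; y-root-suc   = λ i → reflexive (if-yes (root ≟ root) ≡.refl)
    ; y-zero       = λ v v≢r → reflexive (if-no (v ≟ root) v≢r)
    ; y-assign     = λ v v≢r → trans
        (sum-cong-≋ {suc h} {λ i → y v (suc i)} {z v} (λ i → reflexive (if-no (v ≟ root) v≢r))) (sum≈1 v)
    ; link         = λ u v u≢v i → shifted-≤ (y-link u v u≢v i)
    ; link-last    = y-link-last
    ; y-bounds     = y-bounds
    }
    where
    open Instance I
    open PPoint p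
    open PPolyhedron feasible
    open XConstraints xConstraints

    -- Nothing lies before position 0: the link there is bounded by l u 0 ≤ l u 1 = 0 and g 0 root =
    -- 0. In A this handles the arcs into the root, where y root (i + 1) offers no slack.
    x-into-root : ∀ u → u ≢ root → x u root ≤ 0#
    x-into-root u u≢r = begin
      x u root            ≤⟨ link u root u≢r zero ⟩
      l u zero + g zero root ≤⟨ +-mono-≤ (l-mono u zero) (≤-reflexive g-root) ⟩
      l u (suc zero) + 0# ≈⟨ trans (+-identityʳ _) (l-first u u≢r) ⟩
      0#                  ∎

    inner? : ∀ u v → Dec (u ≢ v × u ≢ root × v ≢ root)
    inner? u v = ¬? (u ≟ v) ×-dec ¬? (u ≟ root) ×-dec ¬? (v ≟ root)

    -- Arcs at the root are zeroed because the root's positions are prescribed. The iteration may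
    -- then run over all nodes, and `y` overwrites the root's row afterwards.
    A : Fin n → Fin n → Carrier
    A u v = if does (inner? u v) then x u v else 0#

    A≥0 : ∀ u v → 0# ≤ A u v
    A≥0 u v = if-elim (inner? u v) (0# ≤_) (λ (u≢v , _) → proj₁ (X3 u v u≢v)) (λ _ → ≤-refl)

    A≤x : ∀ u v → A u v ≤ (if does (¬? (u ≟ v)) then x u v else 0#)
    A≤x u v = if-elim (¬? (u ≟ v)) (A u v ≤_)
      (λ u≢v → if-elim (inner? u v) (_≤ x u v) (λ _ → ≤-refl) (λ _ → proj₁ (X3 u v u≢v)))
      (λ ¬u≢v → ≤-reflexive (reflexive (if-no (inner? u v) (¬u≢v ∘ proj₁))))

    ΣA≤1 : ∀ v → sum (λ u → A u v) ≤ 1#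
    ΣA≤1 v = ≤-trans (sum-mono-≤ (λ u → A≤x u v)) (X1 v)

    -- The root's summand in `A` is 0, so x root v fits in its place within X1.
    x-root+ΣA≤1 : ∀ v → v ≢ root → x root v + sum (λ u → A u v) ≤ 1#
    x-root+ΣA≤1 v v≢r = ≤-trans (term+sum≤sum (λ u → A≤x u v) root (≤-reflexive (begin-equality
      x root v + A root v                                 ≈⟨ +-congˡ (reflexive (if-no (inner? root v) (λ (_ , r≢r , _) → r≢r ≡.refl))) ⟩
      x root v + 0#                                       ≈⟨ +-identityʳ _ ⟩
      x root v                                            ≈⟨ reflexive (if-yes (¬? (root ≟ v)) (≢-sym v≢r)) ⟨
      (if does (¬? (root ≟ v)) then x root v else 0#)     ∎))) (X1 v)

    U : Fin n → Fin (suc h) → Carrier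
    U v i = if does (v ≟ root) then 1# else 1# - l v (suc i)

    U≥0 : ∀ v i → 0# ≤ U v i
    U≥0 v i = if-elim (v ≟ root) (0# ≤_) (λ _ → 0≤1) (λ _ → x≤y⇒0≤y-x (proj₂ (l-bounds v (suc i))))

    U≤1 : ∀ v i → U v i ≤ 1#
    U≤1 v i = if-elim (v ≟ root) (_≤ 1#) (λ _ → ≤-refl)
      (λ _ → x≤y+z⇒x-z≤y (x≤x+y 1# (proj₁ (l-bounds v (suc i)))))

    U-first : ∀ v → 1# ≤ U v zero
    U-first v = if-elim (v ≟ root) (1# ≤_) (λ _ → ≤-refl)
      (λ v≢r → ≤-reflexive (sym (trans (+-congˡ (-‿cong (l-first v v≢r))) 1-0≈1)))

    U-step : ∀ u v i → U u (inject₁ i) + A u v ≤ 1# + U v (suc i)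
    U-step u v i = if-elim (inner? u v) (λ a → U u (inject₁ i) + a ≤ 1# + U v (suc i))
      (λ (u≢v , u≢r , v≢r) → begin
        U u (inject₁ i) + x u v                          ≈⟨ +-congʳ (reflexive (if-no (u ≟ root) u≢r)) ⟩
        -- Index i of `U` is position i + 1, hence the link at `suc (inject₁ i)`.
        1# - lu + x u v                                  ≤⟨ +-monoʳ-≤ _ (link u v u≢v (suc (inject₁ i))) ⟩
        1# - lu + (lu + gv)                              ≈⟨ trans (sym (+-assoc _ _ _)) (+-congʳ (x-z+z≈x 1# lu)) ⟩
        1# + gv                                          ≈⟨ +-congˡ (x+z-z≈x gv lv) ⟨
        1# + (gv + lv - lv)                              ≈⟨ +-congˡ (+-congʳ (g+l v (suc i))) ⟩
        1# + (1# - lv)                                   ≈⟨ +-congˡ (reflexive (if-no (v ≟ root) v≢r)) ⟨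
        1# + U v (suc i)                                 ∎)
      (λ _ → ≤-trans (≤-respˡ-≈ (sym (+-identityʳ _)) (U≤1 u (inject₁ i))) (x≤x+y 1# (U≥0 v (suc i))))
      where
      lu = l u (suc (inject₁ i))
      gv = g (suc (inject₁ i)) v
      lv = l v (suc (suc i))

    U-last : ∀ u v → U u (fromℕ h) + A u v ≤ 1#
    U-last u v = if-elim (inner? u v) (λ a → U u (fromℕ h) + a ≤ 1#)
      (λ (u≢v , u≢r , v≢r) → begin
        U u (fromℕ h) + x u v       ≈⟨ +-congʳ (reflexive (if-no (u ≟ root) u≢r)) ⟩
        1# - lu + x u v             ≤⟨ +-monoʳ-≤ _ (link u v u≢v (suc (fromℕ h))) ⟩
        1# - lu + (lu + g (suc (fromℕ h)) v) ≈⟨ +-congˡ (trans (+-congˡ (g-last v v≢r)) (+-identityʳ lu)) ⟩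
        1# - lu + lu                ≈⟨ x-z+z≈x 1# lu ⟩
        1#                          ∎)
      (λ _ → ≤-respˡ-≈ (sym (+-identityʳ _)) (U≤1 u (fromℕ h)))
      where
      lu = l u (suc (fromℕ h))

    open Assignment A A≥0 ΣA≤1 U U≥0 U-first U-step U-last using (IsAssignment; assignment)

    z : Fin n → Fin (suc h) → Carrier
    z = proj₁ assignment

    open IsAssignment (proj₂ assignment) renaming (y≥0 to z≥0)

    z≤1 : ∀ v i → z v i ≤ 1#
    z≤1 v i = ≤-respʳ-≈ (sum≈1 v) (term≤sum (z≥0 v) i)

    y : Fin n → Position I → Carrier
    y v zero    = if does (v ≟ root) then 1# else 0#
    y v (suc i) = if does (v ≟ root) then 0# else z v i

    y-bounds : ∀ v i → InUnitInterval (y v i)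
    y-bounds v zero    = if-elim (v ≟ root) InUnitInterval (λ _ → 1∈[0,1]) (λ _ → 0∈[0,1])
    y-bounds v (suc i) = if-elim (v ≟ root) InUnitInterval (λ _ → 0∈[0,1]) (λ _ → z≥0 v i , z≤1 v i)

    y≈0⇒link : ∀ u v → u ≢ v → ∀ i j → y u i ≡ 0# → y u i + x u v ≤ 1# + y v j
    y≈0⇒link u v u≢v i j yui≡0 = begin
      y u i + x u v ≈⟨ trans (+-congʳ (reflexive yui≡0)) (+-identityˡ _) ⟩
      x u v         ≤⟨ proj₂ (X3 u v u≢v) ⟩
      1#            ≤⟨ x≤x+y 1# (proj₁ (y-bounds v j)) ⟩
      1# + y v j    ∎

    y-into-root : ∀ u → u ≢ root → ∀ i → y u i + x u root ≤ 1#
    y-into-root u u≢r i = ≤-respʳ-≈ (+-identityʳ 1#) (+-mono-≤ (proj₂ (y-bounds u i)) (x-into-root u u≢r))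

    y-link : ∀ u v → u ≢ v → ∀ (i : Fin (suc h)) → y u (inject₁ i) + x u v ≤ 1# + y v (suc i)
    y-link u v u≢v i = by-cases i (u ≟ root) (v ≟ root)
      where
      by-cases : ∀ (i : Fin (suc h)) → Dec (u ≡ root) → Dec (v ≡ root) → y u (inject₁ i) + x u v ≤ 1# + y v (suc i)
      by-cases i (yes u≡r) (yes v≡r) = contradiction (≡.trans u≡r (≡.sym v≡r)) u≢v
      by-cases i (no u≢r) (yes ≡.refl) =
        ≤-trans (y-into-root u u≢r (inject₁ i)) (x≤x+y 1# (proj₁ (y-bounds root (suc i))))
      by-cases (suc i) (yes u≡r) (no v≢r) =
        y≈0⇒link u v u≢v (suc (inject₁ i)) (suc (suc i)) (if-yes (u ≟ root) u≡r)
      by-cases zero (no u≢r) (no v≢r) = y≈0⇒link u v u≢v zero (suc zero) (if-no (u ≟ root) u≢r)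
      by-cases zero (yes ≡.refl) (no v≢r) = begin
        y root zero + x root v  ≈⟨ +-congʳ (reflexive (if-yes (root ≟ root) ≡.refl)) ⟩
        -- The inflow from the other nodes cancels between X1 and `first`.
        1# + x root v           ≤⟨ +-monoʳ-≤ 1# (+-cancelʳ-≤ _ (≤-trans (x-root+ΣA≤1 v v≢r) (first v))) ⟩
        1# + z v zero           ≈⟨ +-congˡ (reflexive (if-no (v ≟ root) v≢r)) ⟨
        1# + y v (suc zero)     ∎
      by-cases (suc i) (no u≢r) (no v≢r) = begin
        y u (suc (inject₁ i)) + x u v  ≈⟨ +-cong (reflexive (if-no (u ≟ root) u≢r)) (reflexive (≡.sym (if-yes (inner? u v) (u≢v , u≢r , v≢r)))) ⟩
        z u (inject₁ i) + A u v        ≤⟨ step u v i ⟩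
        1# + z v (suc i)               ≈⟨ +-congˡ (reflexive (if-no (v ≟ root) v≢r)) ⟨
        1# + y v (suc (suc i))         ∎

    y-link-last : ∀ u v → u ≢ v → y u (suc (fromℕ h)) + x u v ≤ 1#
    y-link-last u v u≢v = by-cases (u ≟ root) (v ≟ root)
      where
      by-cases : Dec (u ≡ root) → Dec (v ≡ root) → y u (suc (fromℕ h)) + x u v ≤ 1#
      by-cases (yes u≡r) _ = begin
        y u (suc (fromℕ h)) + x u v ≈⟨ trans (+-congʳ (reflexive (if-yes (u ≟ root) u≡r))) (+-identityˡ _) ⟩
        x u v                       ≤⟨ proj₂ (X3 u v u≢v) ⟩
        1#                          ∎
      by-cases (no u≢r) (yes ≡.refl) = y-into-root u u≢r (suc (fromℕ h))
      by-cases (no u≢r) (no v≢r) = begin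
        y u (suc (fromℕ h)) + x u v ≈⟨ +-cong (reflexive (if-no (u ≟ root) u≢r)) (reflexive (≡.sym (if-yes (inner? u v) (u≢v , u≢r , v≢r)))) ⟩
        z u (fromℕ h) + A u v       ≤⟨ last u v ⟩
        1#                          ∎

  -- The two LP values

  P-value : ∀ I → ∃ (IsLPValue (P-HSTP I))
  P-value I = infimum _ (_ , starPoint I , star-feasible I , refl)
    (0# , λ { t (p , feasible , cost≈t) → ≤-respʳ-≈ cost≈t (arcCost-nonNeg I _ (PPolyhedron.xConstraints feasible)) })

  A-value : ∀ I → ∃ (IsLPValue (A-HSTP I))
  A-value I = infimum _ (_ , _ , proj₂ (P⇒A I (starPoint I) (star-feasible I)) , refl)
    (0# , λ { t (p , feasible , cost≈t) → ≤-respʳ-≈ cost≈t (arcCost-nonNeg I _ (APolyhedron.xConstraints feasible)) })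

  A-value≤P-value : ∀ I → proj₁ (A-value I) ≤ proj₁ (P-value I)
  A-value≤P-value I = proj₂ (proj₂ (P-value I)) _ λ { t (p , feasible , cost≈t) →
    proj₁ (proj₂ (A-value I)) t (_ , proj₂ (P⇒A I p feasible) , cost≈t) }

  -- An instance on which the LP values differ

  1≰0 : ¬ 1# ≤ 0#
  1≰0 1≤0 = 0≉1 (antisym 0≤1 1≤0)

  -- The costs are fitted to node multipliers 1, 2, 3: arcs from the root cost the multiplier of
  -- their head, and 1 → 2 and 2 → 3 cost one less. The diagonal is 1 so that positivity can be
  -- decided over all pairs at once.
  costTable : Vec (Vec ℕ 4) 4
  costTable = (1 ∷ 1 ∷ 2 ∷ 3 ∷ [])
            ∷ (1 ∷ 1 ∷ 1 ∷ 3 ∷ [])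
            ∷ (2 ∷ 1 ∷ 1 ∷ 2 ∷ [])
            ∷ (3 ∷ 3 ∷ 2 ∷ 1 ∷ []) ∷ []

  natCost : Fin 4 → Fin 4 → ℕ
  natCost u v = lookup (lookup costTable u) v

  0<n·1 : ∀ {n} → 1 ℕ.≤ n → 0# < n · 1#
  0<n·1 {suc n} _ = n·-nonNeg (suc n) 0≤1
                  , λ 0≈n·1 → 1≰0 (≤-respʳ-≈ (sym 0≈n·1) (x≤x+y 1# (n·-nonNeg n 0≤1)))

  gapInstance : Instance
  gapInstance = record
    { n        = 4
    ; cost     = λ u v → natCost u v · 1#
    ; cost-sym = λ u v _ → reflexive (≡.cong (_· 1#) (from-yes (all? λ u → all? λ v → natCost u v ℕ.≟ natCost v u) u v))
    ; cost-pos = λ u v _ → 0<n·1 (from-yes (all? λ u → all? λ v → 1 ℕ.≤? natCost u v) u v)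
    ; root     = 0F
    ; H        = 2
    ; H≥1      = s≤s z≤n
    }

  -- Unlike con n, this evaluates to n · 1# definitionally.
  lit : ∀ {k} → ℕ → Solve.Polynomial k
  lit zero    = con 0
  lit (suc n) = con 1 :+ lit n

  -- The multipliers 1, 2, 3 of the in-degree constraints and 1 of the path 1 → 2 → 3,
  -- whose two arcs together cannot exceed 1, form an optimal dual solution.
  P-gap-bound : ∀ p → PPolyhedron gapInstance p → 5 · 1# ≤ arcCost gapInstance (PPoint.x p)
  P-gap-bound p feasible = +-cancelʳ-≤ 1# (begin
    5 · 1# + 1#
      ≈⟨ solve 0 (lit 5 :+ con 1 := con 1 :+ lit 2 :* con 1 :+ lit 3 :* con 1) refl ⟩
    1# + 2 · 1# * 1# + 3 · 1# * 1#
      ≤⟨ +-mono-≤ (+-mono-≤ (X4 1F ∈⊤ (λ ())) (*-monoˡ-≤ (n·-nonNeg 2 0≤1) (X4 2F ∈⊤ (λ ()))))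
                  (*-monoˡ-≤ (n·-nonNeg 3 0≤1) (X4 3F ∈⊤ (λ ()))) ⟩
    inflow 1F + 2 · 1# * inflow 2F + 3 · 1# * inflow 3F
      -- The added terms are the arcs of positive reduced cost: those into the root, and 3 → 1.
      ≤⟨ x≤x+y _ (+-nonNeg (+-nonNeg (+-nonNeg (x≥0 1F 0F λ ()) (*-nonNeg (n·-nonNeg 2 0≤1) (x≥0 2F 0F λ ())))
                                     (*-nonNeg (n·-nonNeg 3 0≤1) (x≥0 3F 0F λ ())))
                           (*-nonNeg (n·-nonNeg 2 0≤1) (x≥0 3F 1F λ ()))) ⟩
    inflow 1F + 2 · 1# * inflow 2F + 3 · 1# * inflow 3F
      + (x 1F 0F + 2 · 1# * x 2F 0F + 3 · 1# * x 3F 0F + 2 · 1# * x 3F 1F)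
      -- The zeros are the entries that `sumOver` filters out; keeping them makes both sides match
      -- the unfolded sums definitionally.
      ≈⟨ solve 12 (λ x01 x02 x03 x10 x12 x13 x20 x21 x23 x30 x31 x32 →
           (x01 :+ (con 0 :+ (x21 :+ (x31 :+ con 0))))
             :+ lit 2 :* (x02 :+ (x12 :+ (con 0 :+ (x32 :+ con 0))))
             :+ lit 3 :* (x03 :+ (x13 :+ (x23 :+ (con 0 :+ con 0))))
             :+ (x10 :+ lit 2 :* x20 :+ lit 3 :* x30 :+ lit 2 :* x31)
           := (con 0 :+ (lit 1 :* (x01 :+ x10) :+ (lit 2 :* (x02 :+ x20) :+ (lit 3 :* (x03 :+ x30) :+ con 0))))
                :+ ((con 0 :+ (con 0 :+ (lit 1 :* (x12 :+ x21) :+ (lit 3 :* (x13 :+ x31) :+ con 0))))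
                :+ ((con 0 :+ (con 0 :+ (con 0 :+ (lit 2 :* (x23 :+ x32) :+ con 0))))
                :+ ((con 0 :+ (con 0 :+ (con 0 :+ (con 0 :+ con 0)))) :+ con 0)))
              :+ (x12 :+ x23))
           refl (x 0F 1F) (x 0F 2F) (x 0F 3F) (x 1F 0F) (x 1F 2F) (x 1F 3F)
                (x 2F 0F) (x 2F 1F) (x 2F 3F) (x 3F 0F) (x 3F 1F) (x 3F 2F) ⟩
    arcCost gapInstance x + (x 1F 2F + x 2F 3F)
      ≤⟨ +-monoʳ-≤ _ path ⟩
    arcCost gapInstance x + 1#    ∎)
    where
    open PPoint p
    open PPolyhedron feasible
    open XConstraints xConstraints

    x≥0 : ∀ u v → u ≢ v → 0# ≤ x u v
    x≥0 u v u≢v = proj₁ (X3 u v u≢v)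

    inflow : Fin 4 → Carrier
    inflow v = sumOver (λ u → ¬? (u ≟ v)) λ u → x u v

    path : x 1F 2F + x 2F 3F ≤ 1#
    -- Node 1 never lies before position 1 and node 3 never after H = 2, so what remains is the
    -- complementary pair g 1 2, l 2 2 of node 2.
    path = begin
      x 1F 2F + x 2F 3F                         ≤⟨ +-mono-≤ (link 1F 2F (λ ()) 1F) (link 2F 3F (λ ()) 2F) ⟩
      (l 1F 1F + g 1F 2F) + (l 2F 2F + g 2F 3F) ≈⟨ +-cong (trans (+-congʳ (l-first 1F (λ ()))) (+-identityˡ _))
                                                          (trans (+-congˡ (g-last 3F (λ ()))) (+-identityʳ _)) ⟩
      g 1F 2F + l 2F 2F                         ≈⟨ g+l 2F 1F ⟩
      1#                                        ∎

  2·1≉0 : ¬ (2 · 1# ≈ 0#)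
  2·1≉0 2·1≈0 = proj₂ (0<n·1 {2} (s≤s z≤n)) (sym 2·1≈0)

  ½ : Carrier
  ½ = proj₁ (inverse (2 · 1#) 2·1≉0)

  -- Counting in units of ½ turns every check on the half-integral point into a decidable statement
  -- about natural numbers.
  halves : ℕ → Carrier
  halves k = k · ½

  2-halves : halves 2 ≈ 1#
  2-halves = trans (sym (trans (×-assoc-* 2 1# ½) (×-congʳ 2 (*-identityˡ ½)))) (proj₂ (inverse (2 · 1#) 2·1≉0))

  ½≥0 : 0# ≤ ½
  ½≥0 = inverse-nonNeg (n·-nonNeg 2 0≤1) (proj₂ (inverse (2 · 1#) 2·1≉0))

  halves-mono-≤ : ∀ {j k} → j ℕ.≤ k → halves j ≤ halves k
  halves-mono-≤ {k = k} z≤n = n·-nonNeg k ½≥0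
  halves-mono-≤ (s≤s j≤k)   = +-monoʳ-≤ ½ (halves-mono-≤ j≤k)

  halves-≤1 : ∀ {k} → k ℕ.≤ 2 → halves k ≤ 1#
  halves-≤1 {k} k≤2 = ≤-respʳ-≈ 2-halves (halves-mono-≤ {k} {2} k≤2)

  halves-∈[0,1] : ∀ {k} → k ℕ.≤ 2 → InUnitInterval (halves k)
  halves-∈[0,1] {k} k≤2 = n·-nonNeg k ½≥0 , halves-≤1 {k} k≤2

  natSum : ∀ {n} → (Fin n → ℕ) → ℕ
  natSum = V.foldr ℕ._+_ 0

  natSumOver : ∀ {n} {P : Fin n → Set} → Decidable P → (Fin n → ℕ) → ℕ
  natSumOver P? f = natSum λ i → if does (P? i) then f i else 0

  halves-sum : ∀ {n} (f : Fin n → ℕ) → sum (halves ∘ f) ≈ halves (natSum f)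
  halves-sum {zero}  f = refl
  halves-sum {suc n} f = trans (+-congˡ (halves-sum (f ∘ suc))) (sym (×-homo-+ ½ (f zero) _))

  halves-sumOver : ∀ {n} {P : Fin n → Set} (P? : Decidable P) (f : Fin n → ℕ) →
                   sumOver P? (halves ∘ f) ≈ halves (natSumOver P? f)
  halves-sumOver P? f = trans
    (sum-cong-≋ {x = λ i → if does (P? i) then halves (f i) else 0#} (λ i → reflexive (≡.sym (if-float halves (does (P? i))))))
    (halves-sum λ i → if does (P? i) then f i else 0)

  -- The entries of this and the next table are in units of ½.
  arcTable : Vec (Vec ℕ 4) 4
  arcTable = (0 ∷ 1 ∷ 1 ∷ 0 ∷ [])
           ∷ (0 ∷ 0 ∷ 1 ∷ 0 ∷ [])
           ∷ (0 ∷ 1 ∷ 0 ∷ 2 ∷ [])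
           ∷ (0 ∷ 0 ∷ 0 ∷ 0 ∷ []) ∷ []

  positionTable : Vec (Vec ℕ 3) 4
  positionTable = (2 ∷ 0 ∷ 0 ∷ [])
                ∷ (0 ∷ 1 ∷ 1 ∷ [])
                ∷ (0 ∷ 2 ∷ 0 ∷ [])
                ∷ (0 ∷ 0 ∷ 2 ∷ []) ∷ []

  natArc : Fin 4 → Fin 4 → ℕ
  natArc u v = lookup (lookup arcTable u) v

  natPosition : Fin 4 → Fin 3 → ℕ
  natPosition v i = lookup (lookup positionTable v) i

  -- Node 1 is split evenly over positions 1 and 2, which lets the arcs 1 → 2 and 2 → 1 each carry ½
  -- while node 2 sits wholly at position 1. All in-degrees are 1 and all arcs used have reduced
  -- cost 0, but the path 1 → 2 → 3 carries 3/2 where P allows 1: the cost is 6 - 3/2 instead of 6 -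
  -- 1.
  gapPoint : APoint gapInstance
  gapPoint = record { x = λ u v → halves (natArc u v) ; y = λ v i → halves (natPosition v i) }

  gapPoint-feasible : APolyhedron gapInstance gapPoint
  gapPoint-feasible = record
    { xConstraints = record
      { X1 = λ v → ≤-respˡ-≈ (sym (halves-sumOver (λ u → ¬? (u ≟ v)) (λ u → natArc u v)))
          (halves-≤1 (from-yes (all? λ v → natSumOver (λ u → ¬? (u ≟ v)) (λ u → natArc u v) ℕ.≤? 2) v))
      ; X2 = λ v w v≢r w≢v → ≤-respʳ-≈ (sym (halves-sumOver (λ u → ¬? (u ≟ v) ×-dec ¬? (u ≟ w)) (λ u → natArc u v)))
          (halves-mono-≤ (from-yes (all? λ v → all? λ w → ¬? (v ≟ 0F) →-dec ¬? (w ≟ v) →-dec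
            natArc v w ℕ.≤? natSumOver (λ u → ¬? (u ≟ v) ×-dec ¬? (u ≟ w)) (λ u → natArc u v)) v w v≢r w≢v))
      ; X3 = λ u v _ → halves-∈[0,1] (from-yes (all? λ u → all? λ v → natArc u v ℕ.≤? 2) u v)
      ; X4 = λ v _ v≢r → ≤-respˡ-≈ 2-halves
          (≤-respʳ-≈ (sym (halves-sumOver (λ u → ¬? (u ≟ v)) (λ u → natArc u v)))
            (halves-mono-≤ (from-yes (all? λ v → ¬? (v ≟ 0F) →-dec
              2 ℕ.≤? natSumOver (λ u → ¬? (u ≟ v)) (λ u → natArc u v)) v v≢r)))
      }
    ; y-root-zero = 2-halves
    ; y-root-suc  = λ { 0F → refl ; 1F → refl }
    ; y-zero      = λ v v≢r → reflexive (≡.cong halves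
        (from-yes (all? λ v → ¬? (v ≟ 0F) →-dec natPosition v 0F ℕ.≟ 0) v v≢r))
    ; y-assign    = λ v v≢r → trans (halves-sum λ i → natPosition v (suc i)) (trans (reflexive (≡.cong halves
        (from-yes (all? λ v → ¬? (v ≟ 0F) →-dec natSum (λ i → natPosition v (suc i)) ℕ.≟ 2) v v≢r))) 2-halves)
    ; link        = λ u v u≢v i → shifted-≤ (begin
        halves (natPosition u (inject₁ i)) + halves (natArc u v) ≈⟨ ×-homo-+ ½ (natPosition u (inject₁ i)) (natArc u v) ⟨
        halves (natPosition u (inject₁ i) ℕ.+ natArc u v)        ≤⟨ halves-mono-≤ (from-yes
          (all? λ u → all? λ v → ¬? (u ≟ v) →-dec all? λ i →
            natPosition u (inject₁ i) ℕ.+ natArc u v ℕ.≤? 2 ℕ.+ natPosition v (suc i)) u v u≢v i) ⟩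
        halves (2 ℕ.+ natPosition v (suc i))                     ≈⟨ ×-homo-+ ½ 2 (natPosition v (suc i)) ⟩
        halves 2 + halves (natPosition v (suc i))                ≈⟨ +-congʳ 2-halves ⟩
        1# + halves (natPosition v (suc i))                      ∎)
    ; link-last   = λ u v u≢v → ≤-respˡ-≈ (×-homo-+ ½ (natPosition u 2F) (natArc u v))
        (halves-≤1 (from-yes (all? λ u → all? λ v → ¬? (u ≟ v) →-dec
          natPosition u 2F ℕ.+ natArc u v ℕ.≤? 2) u v u≢v))
    ; y-bounds    = λ v i → halves-∈[0,1] (from-yes (all? λ v → all? λ i → natPosition v i ℕ.≤? 2) v i)
    }

  gapPoint-cost : arcCost gapInstance (APoint.x gapPoint) ≈ halves 9
  gapPoint-cost = trans (sum-cong-≋ {x = λ u → sumOver (λ v → u <? v) (arc u)} row)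
                        (halves-sum λ u → natSumOver (λ v → u <? v) (natArcCost u))
    where
    arc : Fin 4 → Fin 4 → Carrier
    arc u v = natCost u v · 1# * (halves (natArc u v) + halves (natArc v u))

    natArcCost : Fin 4 → Fin 4 → ℕ
    natArcCost u v = natCost u v ℕ.* (natArc u v ℕ.+ natArc v u)

    arc-halves : ∀ u v → arc u v ≈ halves (natArcCost u v)
    arc-halves u v = begin-equality
      c · 1# * (halves (natArc u v) + halves (natArc v u)) ≈⟨ *-congˡ (×-homo-+ ½ (natArc u v) (natArc v u)) ⟨
      c · 1# * halves (natArc u v ℕ.+ natArc v u)          ≈⟨ ×-assoc-* c 1# _ ⟩
      c · (1# * halves (natArc u v ℕ.+ natArc v u))        ≈⟨ ×-congʳ c (*-identityˡ _) ⟩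
      c · halves (natArc u v ℕ.+ natArc v u)               ≈⟨ ×-assocˡ ½ c (natArc u v ℕ.+ natArc v u) ⟩
      halves (natArcCost u v)                              ∎
      where c = natCost u v

    row : ∀ u → sumOver (λ v → u <? v) (arc u) ≈ halves (natSumOver (λ v → u <? v) (natArcCost u))
    row u = trans (sum-cong-≋ {x = λ v → if does (u <? v) then arc u v else 0#}
                              {y = λ v → if does (u <? v) then halves (natArcCost u v) else 0#} entry)
                  (halves-sumOver (λ v → u <? v) (natArcCost u))
      where
      entry : ∀ v → (if does (u <? v) then arc u v else 0#) ≈ (if does (u <? v) then halves (natArcCost u v) else 0#)
      entry v with does (u <? v)
      ... | true  = arc-halves u v
      ... | false = refl

  gap : proj₁ (A-value gapInstance) < proj₁ (P-value gapInstance)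
  gap = A-value≤P-value gapInstance , λ νA≈νP → 1≰0 (begin
    1#       ≈⟨ 2-halves ⟨
    halves 2 ≤⟨ +-mono-≤ (½≤0 νA≈νP) (+-mono-≤ (½≤0 νA≈νP) ≤-refl) ⟩
    0# + (0# + 0#) ≈⟨ trans (+-identityˡ _) (+-identityˡ 0#) ⟩
    0#       ∎)
    where
    ½≤0 : proj₁ (A-value gapInstance) ≈ proj₁ (P-value gapInstance) → ½ ≤ 0#
    ½≤0 νA≈νP = +-cancelʳ-≤ (halves 9) (begin
      -- `halves 10` unfolds to ½ + `halves 9`, so cancelling `halves 9` leaves ½ ≤ 0.
      halves 10     ≈⟨ ×-assocˡ ½ 5 2 ⟨
      5 · halves 2  ≈⟨ ×-congʳ 5 2-halves ⟩
      5 · 1#        ≤⟨ proj₂ (proj₂ (P-value gapInstance)) _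
                         (λ { t (p , feasible , cost≈t) → ≤-respʳ-≈ cost≈t (P-gap-bound p feasible) }) ⟩
      proj₁ (P-value gapInstance) ≈⟨ νA≈νP ⟨
      proj₁ (A-value gapInstance) ≤⟨ proj₁ (proj₂ (A-value gapInstance)) _ (gapPoint , gapPoint-feasible , refl) ⟩
      arcCost gapInstance (APoint.x gapPoint) ≈⟨ gapPoint-cost ⟩
      halves 9      ≈⟨ +-identityˡ _ ⟨
      0# + halves 9 ∎)

  strictlyStronger : StrictlyStronger P-HSTP A-HSTP
  strictlyStronger =
      (λ I → proj₁ (P-value I) , proj₁ (A-value I) , proj₂ (P-value I) , proj₂ (A-value I) , A-value≤P-value I)
    , (gapInstance , proj₁ (P-value gapInstance) , proj₁ (A-value gapInstance)
      , proj₂ (P-value gapInstance) , proj₂ (A-value gapInstance) , gap)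

theorem4 : (ℝ : CompleteOrderedField) → HMSTP.StrictlyStronger ℝ (HMSTP.P-HSTP ℝ) (HMSTP.A-HSTP ℝ)
theorem4 = strictlyStronger
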